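{- Let $n\ge2$, $q\ge2$, $s\ge1$ be integers and let $C\subseteq[q]^n$ be a $(2s-1)$-design with degree $s$ in $H(n,q)$ that is not tight, with degree set $\{\alpha_1,\ldots,\alpha_s\}$. Then \[ q^s\left(\frac{q^{s(s-1)/2}\prod_{1\le i<j\le s}(\alpha_i-\alpha_j)}{\prod_{i=1}^{s-1}i!}\right)^2 \] is an integer dividing $|C|^{2s}$.
   Context: $[q]=\{1,\ldots,q\}$; $\partial$ is Hamming distance. A nonempty $C\subseteq[q]^n$ is a $t$-design in the Hamming scheme $H(n,q)$ if the array of its elements (as rows) is an orthogonal array of strength $t$: in any $t$ columns every element of $[q]^t$ occurs equally often. Its degree set is $\{\partial(x,y):x,y\in C,x\ne y\}$ and its degree is the size of that set. A $(2s-1)$-design is tight if $|C|=\sum_{k=0}^{s-1}\binom{n}{k}(q-1)^k+\binom{n-1}{s-1}(q-1)^s$. -}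

module Defs where

open import Data.Nat using (ℕ; zero; suc; _+_; _*_; _∸_; _^_; _≤_; _!)
open import Data.Nat.Combinatorics using (_C_)
open import Data.Fin using (Fin; zero; suc; _<_)
import Data.Fin as F
open import Data.Vec using (Vec; lookup)
open import Data.List using (List; []; _∷_; length)
open import Data.List.Membership.Propositional using (_∈_)
open import Data.List.Relation.Unary.Unique.Propositional using (Unique)
open import Data.Bool using (Bool; true; false; _∧_; if_then_else_)
open import Data.Integer using (ℤ; +_; _-_) renaming (_*_ to _*ℤ_)
open import Data.Product using (Σ; _×_; ∃)
open import Relation.Binary.PropositionalEquality using (_≡_; _≢_)
open import Relation.Nullary.Decidable using (⌊_⌋)
open import Function.Definitions using (Injective)

Word : ℕ → ℕ → Set
Word q n = Vec (Fin q) n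

sumFin : (k : ℕ) → (Fin k → ℕ) → ℕ
sumFin zero f = 0
sumFin (suc k) f = f zero + sumFin k (λ i → f (suc i))

hamming : ∀ {q n} → Word q n → Word q n → ℕ
hamming {n = n} x y = sumFin n (λ i → if ⌊ lookup x i F.≟ lookup y i ⌋ then 0 else 1)

agreesOn : ∀ {q n t} → (Fin t → Fin n) → (Fin t → Fin q) → Word q n → Bool
agreesOn {t = zero} cols a x = true
agreesOn {t = suc t} cols a x =
  ⌊ lookup x (cols zero) F.≟ a zero ⌋ ∧ agreesOn (λ i → cols (suc i)) (λ i → a (suc i)) x

countRows : ∀ {q n t} → (Fin t → Fin n) → (Fin t → Fin q) → List (Word q n) → ℕ
countRows cols a [] = 0
countRows cols a (x ∷ C) = (if agreesOn cols a x then 1 else 0) + countRows cols a C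

record Code (q n : ℕ) : Set where
  field
    elems    : List (Word q n)
    unique   : Unique elems
    nonempty : elems ≢ []
open Code public

size : ∀ {q n} → Code q n → ℕ
size C = length (elems C)

-- t-design in H(n,q): the rows of C form an orthogonal array of strength t,
-- i.e. for any t distinct columns, every t-tuple occurs equally often.
-- (Strength t is only meaningful for t ≤ n; this is part of the definition.)
IsDesign : ∀ {q n} → ℕ → Code q n → Set
IsDesign {q} {n} t C =
  (t ≤ n) ×
  ((cols : Fin t → Fin n) → Injective _≡_ _≡_ cols →
   (a b : Fin t → Fin q) →
   countRows cols a (elems C) ≡ countRows cols b (elems C))

InDegreeSet : ∀ {q n} → Code q n → ℕ → Set
InDegreeSet C d = Σ _ λ x → Σ _ λ y → (x ∈ elems C) × (y ∈ elems C) × (x ≢ y) × (hamming x y ≡ d)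

-- the tight size for a (2s-1)-design
tightSize : ℕ → ℕ → ℕ → ℕ
tightSize n q s = sumFin s (λ k → (n C F.toℕ k) * (q ∸ 1) ^ F.toℕ k) + ((n ∸ 1) C (s ∸ 1)) * (q ∸ 1) ^ s

prodFinℤ : (k : ℕ) → (Fin k → ℤ) → ℤ
prodFinℤ zero f = + 1
prodFinℤ (suc k) f = f zero *ℤ prodFinℤ k (λ i → f (suc i))

vandermonde : ∀ {s} → (Fin s → ℕ) → ℤ
vandermonde {s} α = prodFinℤ s (λ i → prodFinℤ s (λ j → if ⌊ i F.<? j ⌋ then (+ α i - + α j) else + 1))

superfact : ℕ → ℕ
superfact s = prodN (s ∸ 1)
  where
  prodN : ℕ → ℕ
  prodN zero = 1
  prodN (suc k) = (suc k) ! * prodN k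

{-# OPTIONS --safe #-}

-- Split C by its first coordinate into blocks of size |C|/q. Words x, y in different blocks have
-- g(x,y) = n - ∂(x,y) agreements, all outside the first coordinate, so g takes only the values
-- gᵢ = n - αᵢ. Strength 2s-1 makes the Krawtchouk kernels K₀, …, K_{s-1} on the last n-1
-- coordinates orthogonal on each block, and interpolation at the gᵢ shows that the 0/1 matrix
-- [g(x,y) = gᵢ] maps Kⱼ on one block to pᵢⱼ Kⱼ on the other, with pᵢⱼ rational. Since the powers of pᵢⱼ
-- have bounded denominators, pᵢⱼ is an integer. Expanding q^k C(g,k) in the kernels, with
-- unitriangular coefficients, gives q B p = |C| A where B = (q^k C(gᵢ,k)) and det A = 1. Hence
-- q^s det B det p = |C|^s, and det B is the Vandermonde quotient of the statement, so its square
-- times q^s divides |C|^{2s}.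
module Submission where

-- Different blocks are compared because two words there are never equal, so the value n of the
-- number of agreements, which would be an extra node, does not occur. Exactly s values remain:
-- interpolation has degree s - 1, and the eigenvalues form a square matrix against the s kernels.
-- The strength is used up exactly, with degree s - 1 for the interpolating polynomial, s - 1 for
-- the kernel and 1 for fixing the first letter. The denominators are bounded because one and the
-- same rational eigenvalue pᵢⱼ serves every ordered pair of different blocks. Passing m times to
-- another block multiplies Kⱼ(x,w) by the m-th power of pᵢⱼ, while a 0/1 matrix keeps integral
-- functions integral. At w = x the fixed nonzero integer Kⱼ(x,x) therefore clears the denominators
-- of all powers at once. No rational number is ever formed: averages and eigenvalues appear with
-- their denominators multiplied out, and a factor is cancelled only once it is known to be nonzero.

-- Finite sums of integers.

module Sums where

  open import Data.Nat using (zero; suc)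
  open import Data.Integer using (ℤ; _+_; _*_; 0ℤ)
  open import Data.Integer.Properties using (+-*-semiring)
  open import Data.Fin using (Fin; zero; suc; punchIn; inject₁; fromℕ)
  open import Data.Vec.Functional using (Vector)
  open import Relation.Binary.PropositionalEquality
  open import Function using (_∘_)
  import Algebra.Properties.Semiring.Sum +-*-semiring as S

  -- Opaque so that unification never unfolds a sum whose length is still unknown.
  opaque
    ∑ : ∀ {n} → Vector ℤ n → ℤ
    ∑ = S.sum

    ∑-empty : (f : Vector ℤ 0) → ∑ f ≡ 0ℤ
    ∑-empty f = refl

    ∑-suc : ∀ {n} (f : Vector ℤ (suc n)) → ∑ f ≡ f zero + ∑ (f ∘ suc)
    ∑-suc f = refl

    ∑-cong : ∀ {n} {f g : Vector ℤ n} → f ≗ g → ∑ f ≡ ∑ g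
    ∑-cong = S.sum-cong-≗

    ∑-zero : ∀ {n} {f : Vector ℤ n} → (∀ i → f i ≡ 0ℤ) → ∑ f ≡ 0ℤ
    ∑-zero {n} f≡0 = trans (S.sum-cong-≗ f≡0) (S.sum-replicate-zero n)

    ∑-+ : ∀ {n} (f g : Vector ℤ n) → ∑ (λ i → f i + g i) ≡ ∑ f + ∑ g
    ∑-+ = S.∑-distrib-+

    ∑-*ˡ : ∀ {n} c (f : Vector ℤ n) → c * ∑ f ≡ ∑ λ i → c * f i
    ∑-*ˡ = S.*-distribˡ-sum

    ∑-*ʳ : ∀ {n} c (f : Vector ℤ n) → ∑ f * c ≡ ∑ λ i → f i * c
    ∑-*ʳ = S.*-distribʳ-sum

    ∑-swap : ∀ {m n} (f : Fin m → Fin n → ℤ) → ∑ (λ i → ∑ (f i)) ≡ ∑ λ j → ∑ λ i → f i j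
    ∑-swap = S.∑-comm

    ∑-remove : ∀ {n} k (f : Vector ℤ (suc n)) → ∑ f ≡ f k + ∑ (f ∘ punchIn k)
    ∑-remove k = S.sum-remove {i = k}

    ∑-init-last : ∀ {n} (f : Vector ℤ (suc n)) → ∑ f ≡ ∑ (f ∘ inject₁) + f (fromℕ n)
    ∑-init-last = S.sum-init-last

-- Determinants over the integers: multiplicativity and triangular matrices.

module Determinant where

  open import Defs using (prodFinℤ)
  open import Data.Nat using (ℕ; zero; suc; z<s; s<s)
  open import Data.Integer using (ℤ; -_; _+_; _*_; _-_; _^_; 0ℤ; 1ℤ)
  open import Data.Integer.Properties using (+-comm; +-inverseʳ; *-zeroʳ; *-assoc; *-identityˡ; +-identityˡ; +-identityʳ; *-cancelˡ-≡)
  open import Data.Integer.Tactic.RingSolver using (solve-∀)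
  open import Data.Fin using (Fin; zero; suc; punchIn; lift; _<_)
  open import Data.Vec.Functional using (Vector; _∷_)
  open import Relation.Binary.PropositionalEquality
  open import Function using (_∘_)
  open Sums

  open ≡-Reasoning

  Matrix : ℕ → ℕ → Set
  Matrix m n = Fin m → Fin n → ℤ

  sgn : ∀ {n} → Fin n → ℤ
  sgn zero    = 1ℤ
  sgn (suc i) = - sgn i

  opaque
    -- The vector `d` stands for the minors but is not tied to any matrix, so linearity in the
    -- expanded row and linearity in the minors become two independent facts about a bilinear form.
    laplace : ∀ {n} → Vector ℤ n → Vector ℤ n → ℤ
    laplace v d = ∑ λ j → sgn j * v j * d j

    laplace-empty : (v d : Vector ℤ 0) → laplace v d ≡ 0ℤ
    laplace-empty v d = ∑-empty _

    laplace-suc : ∀ {n} (v d : Vector ℤ (suc n)) → laplace v d ≡ v zero * d zero - laplace (v ∘ suc) (d ∘ suc)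
    laplace-suc v d = begin
      laplace v d
        ≡⟨ ∑-suc _ ⟩
      1ℤ * v zero * d zero + ∑ (λ j → (- sgn j) * v (suc j) * d (suc j))
        ≡⟨ cong (1ℤ * v zero * d zero +_) (trans (∑-cong λ j → neg (sgn j) (v (suc j)) (d (suc j)))
            (sym (∑-*ˡ (- 1ℤ) _))) ⟩
      1ℤ * v zero * d zero + - 1ℤ * laplace (v ∘ suc) (d ∘ suc)
        ≡⟨ tidy (v zero) (d zero) (laplace (v ∘ suc) (d ∘ suc)) ⟩
      v zero * d zero - laplace (v ∘ suc) (d ∘ suc) ∎
      where
      neg : ∀ s u φ → (- s) * u * φ ≡ - 1ℤ * (s * u * φ)
      neg = solve-∀
      tidy : ∀ a b c → 1ℤ * a * b + - 1ℤ * c ≡ a * b - c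
      tidy = solve-∀

    laplace-vanish : ∀ {n} (v d : Vector ℤ n) → (∀ j → v j * d j ≡ 0ℤ) → laplace v d ≡ 0ℤ
    laplace-vanish v d vd≡0 = ∑-zero λ j → trans (*-assoc (sgn j) (v j) (d j))
        (trans (cong (sgn j *_) (vd≡0 j)) (*-zeroʳ (sgn j)))

    laplace-comb : ∀ {n} (v d e : Vector ℤ n) c → laplace v (λ j → c * d j - e j)
        ≡ c * laplace v d - laplace v e
    laplace-comb v d e c = begin
      laplace v (λ j → c * d j - e j)
        ≡⟨ ∑-cong (λ j → distrib (sgn j) (v j) c (d j) (e j)) ⟩
      ∑ (λ j → c * (sgn j * v j * d j) + - 1ℤ * (sgn j * v j * e j))
        ≡⟨ ∑-+ _ _ ⟩
      ∑ (λ j → c * (sgn j * v j * d j)) + ∑ (λ j → - 1ℤ * (sgn j * v j * e j))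
        ≡⟨ cong₂ _+_ (∑-*ˡ c _) (∑-*ˡ (- 1ℤ) _) ⟨
      c * laplace v d + - 1ℤ * laplace v e
        ≡⟨ tidy (c * laplace v d) (laplace v e) ⟩
      c * laplace v d - laplace v e ∎
      where
      distrib : ∀ s v c d e → s * v * (c * d - e) ≡ c * (s * v * d) + - 1ℤ * (s * v * e)
      distrib = solve-∀
      tidy : ∀ a c → a + - 1ℤ * c ≡ a - c
      tidy = solve-∀

    laplace-*ʳ : ∀ {n} (v d : Vector ℤ n) c → laplace v d * c ≡ ∑ λ j → sgn j * v j * d j * c
    laplace-*ʳ v d c = ∑-*ʳ c _

    laplace-cong : ∀ {n} {v w d e : Vector ℤ n} → v ≗ w → d ≗ e → laplace v d ≡ laplace w e
    laplace-cong v≗w d≗e = ∑-cong λ j → cong₂ (λ a b → sgn j * a * b) (v≗w j) (d≗e j)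

    laplace-+ : ∀ {n} (v w d : Vector ℤ n) c → laplace (λ j → v j + c * w j) d ≡ laplace v d + c * laplace w d
    laplace-+ v w d c = begin
      laplace (λ j → v j + c * w j) d
        ≡⟨ ∑-cong (λ j → distrib (sgn j) (v j) c (w j) (d j)) ⟩
      ∑ (λ j → sgn j * v j * d j + c * (sgn j * w j * d j))
        ≡⟨ ∑-+ _ _ ⟩
      laplace v d + ∑ (λ j → c * (sgn j * w j * d j))
        ≡⟨ cong (laplace v d +_) (∑-*ˡ c _) ⟨
      laplace v d + c * laplace w d ∎
      where
      distrib : ∀ s v c w d → s * (v + c * w) * d ≡ s * v * d + c * (s * w * d)
      distrib = solve-∀

    laplace-scale : ∀ {n} (v d : Vector ℤ n) c → laplace v (λ j → c * d j) ≡ c * laplace v d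
    laplace-scale v d c = trans (∑-cong λ j → pull (sgn j) (v j) c (d j)) (sym (∑-*ˡ c _))
      where
      pull : ∀ s v c d → s * v * (c * d) ≡ c * (s * v * d)
      pull = solve-∀

    laplace-sum : ∀ {m n} (c : Vector ℤ m) (V : Matrix m n) (d : Vector ℤ n) →
      laplace (λ j → ∑ λ k → c k * V k j) d ≡ ∑ λ k → c k * laplace (V k) d
    laplace-sum c V d = begin
      laplace (λ j → ∑ λ k → c k * V k j) d
        ≡⟨ ∑-cong (λ j → trans (cong (_* d j) (∑-*ˡ (sgn j) _)) (∑-*ʳ (d j) _)) ⟩
      ∑ (λ j → ∑ λ k → sgn j * (c k * V k j) * d j)
        ≡⟨ ∑-swap _ ⟩
      ∑ (λ k → ∑ λ j → sgn j * (c k * V k j) * d j)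
        ≡⟨ ∑-cong (λ k → trans (∑-cong λ j → pull (sgn j) (c k) (V k j) (d j)) (sym (∑-*ˡ (c k) _))) ⟩
      ∑ (λ k → c k * laplace (V k) d) ∎
      where
      pull : ∀ s c v d → s * (c * v) * d ≡ c * (s * v * d)
      pull = solve-∀

  det : ∀ {n} → Matrix n n → ℤ
  minors : ∀ {n} → Matrix n (suc n) → Vector ℤ (suc n)
  det {zero}  M = 1ℤ
  det {suc n} M = laplace (M zero) (minors (M ∘ suc))
  minors R j = det λ i l → R i (punchIn j l)

  det-cong : ∀ {n} {M N : Matrix n n} → (∀ i j → M i j ≡ N i j) → det M ≡ det N
  minors-cong : ∀ {n} {R S : Matrix n (suc n)} → (∀ i j → R i j ≡ S i j) → minors R ≗ minors S
  det-cong {zero}  M≡N = refl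
  det-cong {suc n} M≡N = laplace-cong (M≡N zero) (minors-cong (M≡N ∘ suc))
  minors-cong R≡S j = det-cong λ i l → R≡S i (punchIn j l)

  -- Φ stands for the minors complementary to the two expanded rows.
  laplace₂ : ∀ {n} → (v w : Vector ℤ (suc (suc n))) → ((Fin n → Fin (suc (suc n))) → ℤ) → ℤ
  laplace₂ v w Φ = laplace v λ j → laplace (w ∘ punchIn j) λ l → Φ (punchIn j ∘ punchIn l)

  -- Induction on the size. The terms in which one of the two rows uses column 0 are visibly
  -- antisymmetric in `v` and `w`; the terms in which neither does (`rest`) are the same statement
  -- with one column fewer. `Φ-cong` is assumed because column selections agree only pointwise.
  laplace₂-swap : ∀ {n} (v w : Vector ℤ (suc (suc n))) (Φ : (Fin n → Fin (suc (suc n))) → ℤ) →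
    (∀ {c d} → c ≗ d → Φ c ≡ Φ d) → laplace₂ v w Φ + laplace₂ w v Φ ≡ 0ℤ
  laplace₂-swap {n} v w Φ Φ-cong = begin
    laplace₂ v w Φ + laplace₂ w v Φ
      ≡⟨ cong₂ _+_ (split v w) (split w v) ⟩
    (v zero * edge w - w zero * edge v + rest v w) + (w zero * edge v - v zero * edge w + rest w v)
      ≡⟨ cancel (v zero * edge w) (w zero * edge v) (rest v w) (rest w v) ⟩
    rest v w + rest w v
      ≡⟨ rest-swap n v w Φ Φ-cong ⟩
    0ℤ ∎
    where
    edge : Vector ℤ (suc (suc n)) → ℤ
    edge u = laplace (u ∘ suc) λ l → Φ (suc ∘ punchIn l)
    inner : Vector ℤ (suc (suc n)) → Vector ℤ (suc n)
    inner u j = laplace (λ l → u (suc (punchIn j l))) λ l → Φ (punchIn (suc j) ∘ punchIn (suc l))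
    rest : (u x : Vector ℤ (suc (suc n))) → ℤ
    rest u x = laplace (u ∘ suc) (inner x)

    cancel : ∀ a b r s → (a - b + r) + (b - a + s) ≡ r + s
    cancel = solve-∀

    regroup : ∀ a b r → a - (b - r) ≡ a - b + r
    regroup = solve-∀

    split : ∀ u x → laplace₂ u x Φ ≡ u zero * edge x - x zero * edge u + rest u x
    split u x = begin
      laplace₂ u x Φ
        ≡⟨ laplace-suc u _ ⟩
      u zero * edge x - laplace (u ∘ suc) (λ j → laplace (x ∘ punchIn (suc j)) λ l → Φ
          (punchIn (suc j) ∘ punchIn l))
        ≡⟨ cong (λ t → u zero * edge x - t) (laplace-cong {v = u ∘ suc} (λ _ → refl) λ j → laplace-suc
            (x ∘ punchIn (suc j)) _) ⟩
      u zero * edge x - laplace (u ∘ suc) (λ j → x zero * Φ (suc ∘ punchIn j) - inner x j)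
        ≡⟨ cong (λ t → u zero * edge x - t) (laplace-comb (u ∘ suc) (λ j → Φ (suc ∘ punchIn j)) (inner x)
            (x zero)) ⟩
      u zero * edge x - (x zero * edge u - rest u x)
        ≡⟨ regroup (u zero * edge x) (x zero * edge u) (rest u x) ⟩
      u zero * edge x - x zero * edge u + rest u x ∎

    rest-swap : ∀ n (v w : Vector ℤ (suc (suc n))) (Φ : (Fin n → Fin (suc (suc n))) → ℤ) →
      (∀ {c d} → c ≗ d → Φ c ≡ Φ d) →
      laplace (v ∘ suc) (λ j → laplace (λ l → w (suc (punchIn j l))) λ l → Φ
          (punchIn (suc j) ∘ punchIn (suc l)))
      + laplace (w ∘ suc) (λ j → laplace (λ l → v (suc (punchIn j l))) λ l → Φ
          (punchIn (suc j) ∘ punchIn (suc l))) ≡ 0ℤ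
    rest-swap zero v w Φ Φ-cong = cong₂ _+_ (empty v w) (empty w v)
      where
      empty : ∀ u x → laplace (u ∘ suc) (λ j → laplace (λ l → x (suc (punchIn j l))) λ l → Φ
          (punchIn (suc j) ∘ punchIn (suc l))) ≡ 0ℤ
      empty u x = laplace-vanish (u ∘ suc) _ λ j → trans (cong (u (suc j) *_) (laplace-empty _ _))
          (*-zeroʳ (u (suc j)))
    -- Column 0 now always belongs to the complementary minor; `lift 1` keeps it there while the
    -- remaining columns are chosen one size lower.
    rest-swap (suc n) v w Φ Φ-cong = trans (cong₂ _+_ (lifted v w) (lifted w v))
        (laplace₂-swap (v ∘ suc) (w ∘ suc) (Φ ∘ lift 1) λ c≗d → Φ-cong
        λ { zero → refl ; (suc i) → cong suc (c≗d i) })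
      where
      lifted : ∀ u x → laplace (u ∘ suc) (λ j → laplace (λ l → x (suc (punchIn j l))) λ l → Φ
          (punchIn (suc j) ∘ punchIn (suc l))) ≡ laplace₂ (u ∘ suc) (x ∘ suc) (Φ ∘ lift 1)
      lifted u x = laplace-cong (λ _ → refl) λ j → laplace-cong (λ _ → refl) λ l → Φ-cong
          λ { zero → refl ; (suc i) → refl }

  det-swap : ∀ {n} (v w : Vector ℤ (suc (suc n))) (R : Matrix n (suc (suc n))) →
    det (v ∷ w ∷ R) ≡ - det (w ∷ v ∷ R)
  det-swap v w R = begin
    det (v ∷ w ∷ R)
      ≡⟨ move (det (v ∷ w ∷ R)) (det (w ∷ v ∷ R)) ⟩
    (det (v ∷ w ∷ R) + det (w ∷ v ∷ R)) - det (w ∷ v ∷ R)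
      ≡⟨ cong (_- det (w ∷ v ∷ R)) (laplace₂-swap v w (λ c → det λ i l → R i (c l)) λ c≗d → det-cong
          λ i l → cong (R i) (c≗d l)) ⟩
    0ℤ - det (w ∷ v ∷ R)
      ≡⟨ +-identityˡ _ ⟩
    - det (w ∷ v ∷ R) ∎
    where
    move : ∀ a b → a ≡ (a + b) - b
    move = solve-∀

  det-repeat : ∀ {n} (v : Vector ℤ (suc (suc n))) (R : Matrix n (suc (suc n))) → det (v ∷ v ∷ R) ≡ 0ℤ
  det-repeat v R = *-cancelˡ-≡ (1ℤ + 1ℤ) _ _ (begin
    (1ℤ + 1ℤ) * det (v ∷ v ∷ R)       ≡⟨ double (det (v ∷ v ∷ R)) ⟩
    det (v ∷ v ∷ R) + det (v ∷ v ∷ R) ≡⟨ cong (det (v ∷ v ∷ R) +_) (det-swap v v R) ⟩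
    det (v ∷ v ∷ R) - det (v ∷ v ∷ R) ≡⟨ +-inverseʳ (det (v ∷ v ∷ R)) ⟩
    0ℤ                                ∎)
    where
    double : ∀ a → (1ℤ + 1ℤ) * a ≡ a + a
    double = solve-∀

  -- Swap `v` below the first sheared row. By linearity this row contributes its unsheared form plus
  -- a multiple of a determinant in which `v` occurs twice. In what remains, every minor is again
  -- sheared by the restriction of `v`, so the induction hypothesis applies.
  det-shear : ∀ {n} (v : Vector ℤ (suc n)) (R : Matrix n (suc n)) (c : Vector ℤ n) →
    det (v ∷ λ i j → R i j + c i * v j) ≡ det (v ∷ R)
  det-shear {zero} v R c = refl
  det-shear {suc n} v R c = begin
    det (v ∷ R′)
      ≡⟨⟩
    det (v ∷ R′ zero ∷ R′ ∘ suc)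
      ≡⟨ det-swap v (R′ zero) (R′ ∘ suc) ⟩
    - laplace (R′ zero) (minors (v ∷ R′ ∘ suc))
      ≡⟨ cong -_ (laplace-+ (R zero) v _ (c zero)) ⟩
    - (laplace (R zero) (minors (v ∷ R′ ∘ suc)) + c zero * det (v ∷ v ∷ R′ ∘ suc))
      ≡⟨ cong (λ t → - (laplace (R zero) (minors (v ∷ R′ ∘ suc)) + t))
          (trans (cong (c zero *_) (det-repeat v (R′ ∘ suc))) (*-zeroʳ (c zero))) ⟩
    - (laplace (R zero) (minors (v ∷ R′ ∘ suc)) + 0ℤ)
      ≡⟨ cong -_ (+-identityʳ _) ⟩
    - laplace (R zero) (minors (v ∷ R′ ∘ suc))
      ≡⟨ cong -_ (laplace-cong {v = R zero} (λ _ → refl) λ j → det-shear (v ∘ punchIn j)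
          (λ i l → R (suc i) (punchIn j l)) (c ∘ suc)) ⟩
    - det (R zero ∷ v ∷ R ∘ suc)
      ≡⟨ det-swap v (R zero) (R ∘ suc) ⟨
    det (v ∷ R zero ∷ R ∘ suc)
      ≡⟨⟩
    det (v ∷ R) ∎
    where
    R′ : Matrix (suc n) (suc (suc n))
    R′ i j = R i j + c i * v j

  det-cycle : ∀ {n} (M : Matrix (suc n) (suc n)) k → det (M k ∷ M ∘ punchIn k) ≡ sgn k * det M
  det-cycle M zero = sym (*-identityˡ (det M))
  det-cycle {suc n} M (suc k) = begin
    det (M (suc k) ∷ M ∘ punchIn (suc k))
      ≡⟨⟩
    det (M (suc k) ∷ M zero ∷ M ∘ suc ∘ punchIn k)
      ≡⟨ det-swap (M (suc k)) (M zero) (M ∘ suc ∘ punchIn k) ⟩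
    - laplace (M zero) (minors (M (suc k) ∷ M ∘ suc ∘ punchIn k))
      ≡⟨ cong -_ (laplace-cong {v = M zero} (λ _ → refl) λ j → det-cycle (λ i l → M (suc i) (punchIn j l)) k) ⟩
    - laplace (M zero) (λ j → sgn k * minors (M ∘ suc) j)
      ≡⟨ cong -_ (laplace-scale (M zero) (minors (M ∘ suc)) (sgn k)) ⟩
    - (sgn k * det M)
      ≡⟨ neg (sgn k) (det M) ⟩
    (- sgn k) * det M ∎
    where
    neg : ∀ s d → - (s * d) ≡ (- s) * d
    neg = solve-∀

  infixl 7 _⊗_
  _⊗_ : ∀ {l m n} → Matrix l m → Matrix m n → Matrix l n
  (M ⊗ N) i j = ∑ λ k → M i k * N k j

  -- Expand M ⊗ N along row 0, whose k-th summand is a multiple of row k of N;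
  -- subtracting it from the other rows leaves a product of matrices of smaller size.
  det-⊗ : ∀ {n} (M N : Matrix n n) → det (M ⊗ N) ≡ det M * det N
  det-⊗ {zero} M N = refl
  det-⊗ {suc n} M N = begin
    det (M ⊗ N)
      ≡⟨ laplace-sum (M zero) N (minors ((M ⊗ N) ∘ suc)) ⟩
    ∑ (λ k → M zero k * det (N k ∷ (M ⊗ N) ∘ suc))
      ≡⟨ ∑-cong (λ k → cong (M zero k *_) (summand k)) ⟩
    ∑ (λ k → M zero k * (minors (M ∘ suc) k * (sgn k * det N)))
      ≡⟨ ∑-cong (λ k → regroup (M zero k) (minors (M ∘ suc) k) (sgn k) (det N)) ⟩
    ∑ (λ k → sgn k * M zero k * minors (M ∘ suc) k * det N)
      ≡⟨ laplace-*ʳ (M zero) (minors (M ∘ suc)) (det N) ⟨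
    det M * det N ∎
    where
    regroup : ∀ m d s e → m * (d * (s * e)) ≡ s * m * d * e
    regroup = solve-∀
    summand : ∀ k → det (N k ∷ (M ⊗ N) ∘ suc) ≡ minors (M ∘ suc) k * (sgn k * det N)
    summand k = begin
      det (N k ∷ (M ⊗ N) ∘ suc)
        ≡⟨ laplace-cong {v = N k} (λ _ → refl) (minors-cong λ i j → trans
            (∑-remove k (λ l → M (suc i) l * N l j)) (+-comm (M (suc i) k * N k j) _)) ⟩
      det (N k ∷ λ i j → (M′ ⊗ N′) i j + M (suc i) k * N k j)
        ≡⟨ det-shear (N k) (M′ ⊗ N′) (λ i → M (suc i) k) ⟩
      laplace (N k) (minors (M′ ⊗ N′))
        ≡⟨ laplace-cong {v = N k} (λ _ → refl) (λ j → det-⊗ M′ (λ i l → N′ i (punchIn j l))) ⟩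
      laplace (N k) (λ j → det M′ * minors N′ j)
        ≡⟨ laplace-scale (N k) (minors N′) (det M′) ⟩
      det M′ * det (N k ∷ N′)
        ≡⟨ cong (det M′ *_) (det-cycle N k) ⟩
      det M′ * (sgn k * det N) ∎
      where
      M′ : Matrix n n
      M′ i l = M (suc i) (punchIn k l)
      N′ : Matrix n (suc n)
      N′ = N ∘ punchIn k

  ∏ : ∀ {n} → Vector ℤ n → ℤ
  ∏ = prodFinℤ _

  ∏-cong : ∀ {n} {f g : Vector ℤ n} → f ≗ g → ∏ f ≡ ∏ g
  ∏-cong {zero}  f≗g = refl
  ∏-cong {suc n} f≗g = cong₂ _*_ (f≗g zero) (∏-cong (f≗g ∘ suc))

  ∏-* : ∀ {n} (f g : Vector ℤ n) → ∏ (λ i → f i * g i) ≡ ∏ f * ∏ g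
  ∏-* {zero}  f g = refl
  ∏-* {suc n} f g = trans (cong (f zero * g zero *_) (∏-* (f ∘ suc) (g ∘ suc)))
      (interchange (f zero) (g zero) (∏ (f ∘ suc)) (∏ (g ∘ suc)))
    where
    interchange : ∀ a b c d → a * b * (c * d) ≡ a * c * (b * d)
    interchange = solve-∀

  ∏-const : ∀ n c → ∏ {n} (λ _ → c) ≡ c ^ n
  ∏-const zero    c = refl
  ∏-const (suc n) c = cong (c *_) (∏-const n c)

  ∏-one : ∀ {n} {f : Vector ℤ n} → (∀ i → f i ≡ 1ℤ) → ∏ f ≡ 1ℤ
  ∏-one {zero}  f≡1 = refl
  ∏-one {suc n} f≡1 = cong₂ _*_ (f≡1 zero) (∏-one (f≡1 ∘ suc))

  laplace-head : ∀ {n} (v d : Vector ℤ (suc n)) → (∀ j → v (suc j) * d (suc j) ≡ 0ℤ) → laplace v d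
      ≡ v zero * d zero
  laplace-head v d tail≡0 = begin
    laplace v d
      ≡⟨ laplace-suc v d ⟩
    v zero * d zero - laplace (v ∘ suc) (d ∘ suc)
      ≡⟨ cong (λ t → v zero * d zero - t) (laplace-vanish (v ∘ suc) (d ∘ suc) tail≡0) ⟩
    v zero * d zero - 0ℤ
      ≡⟨ +-identityʳ _ ⟩
    v zero * d zero ∎

  det-lower : ∀ {n} (M : Matrix n n) → (∀ {i j} → i < j → M i j ≡ 0ℤ) → det M ≡ ∏ λ i → M i i
  det-lower {zero}  M M≡0 = refl
  det-lower {suc n} M M≡0 = trans
    (laplace-head (M zero) (minors (M ∘ suc)) λ j → cong (_* minors (M ∘ suc) (suc j)) (M≡0 z<s))
    (cong (M zero zero *_) (det-lower (λ i l → M (suc i) (suc l)) λ i<j → M≡0 (s<s i<j)))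

  det-zero-column : ∀ {n} (M : Matrix (suc n) (suc n)) → (∀ i → M i zero ≡ 0ℤ) → det M ≡ 0ℤ
  det-zero-column {n} M M≡0 = trans
    (laplace-head (M zero) (minors (M ∘ suc)) (λ j → trans (cong (M zero (suc j) *_) (minor≡0 n M M≡0 j))
        (*-zeroʳ (M zero (suc j)))))
    (cong (_* minors (M ∘ suc) zero) (M≡0 zero))
    where
    minor≡0 : ∀ n (M : Matrix (suc n) (suc n)) → (∀ i → M i zero ≡ 0ℤ) → ∀ j → minors (M ∘ suc) (suc j) ≡ 0ℤ
    minor≡0 (suc n) M M≡0 j = det-zero-column (λ i l → M (suc i) (punchIn (suc j) l)) λ i → M≡0 (suc i)

  det-upper : ∀ {n} (M : Matrix n n) → (∀ {i j} → j < i → M i j ≡ 0ℤ) → det M ≡ ∏ λ i → M i i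
  det-upper {zero}  M M≡0 = refl
  det-upper {suc n} M M≡0 = trans
    (laplace-head (M zero) (minors (M ∘ suc)) (λ j → trans (cong (M zero (suc j) *_) (minor≡0 n M M≡0 j))
        (*-zeroʳ (M zero (suc j)))))
    (cong (M zero zero *_) (det-upper (λ i l → M (suc i) (suc l)) λ j<i → M≡0 (s<s j<i)))
    where
    minor≡0 : ∀ n (M : Matrix (suc n) (suc n)) → (∀ {i j} → j < i → M i j ≡ 0ℤ) → ∀ j → minors (M ∘ suc) (suc j)
        ≡ 0ℤ
    minor≡0 (suc n) M M≡0 j = det-zero-column (λ i l → M (suc i) (punchIn (suc j) l)) λ i → M≡0 z<s

  det-scale : ∀ {n} (c : Vector ℤ n) (M : Matrix n n) → det (λ i j → c i * M i j) ≡ ∏ c * det M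
  det-scale {zero}  c M = refl
  det-scale {suc n} c M = begin
    laplace (λ j → c zero * M zero j) (minors λ i j → c (suc i) * M (suc i) j)
      -- Writing the row as zero plus a multiple gives it the shape from which `laplace-+` extracts
      -- the scalar.
      ≡⟨ laplace-cong {v = λ j → c zero * M zero j} (λ j → sym (+-identityˡ (c zero * M zero j)))
          (λ j → det-scale (c ∘ suc) (λ i l → M (suc i) (punchIn j l))) ⟩
    laplace (λ j → 0ℤ + c zero * M zero j) (λ j → ∏ (c ∘ suc) * minors (M ∘ suc) j)
      ≡⟨ laplace-scale _ (minors (M ∘ suc)) (∏ (c ∘ suc)) ⟩
    ∏ (c ∘ suc) * laplace (λ j → 0ℤ + c zero * M zero j) (minors (M ∘ suc))
      ≡⟨ cong (∏ (c ∘ suc) *_) (laplace-+ (λ _ → 0ℤ) (M zero) (minors (M ∘ suc)) (c zero)) ⟩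
    ∏ (c ∘ suc) * (laplace (λ _ → 0ℤ) (minors (M ∘ suc)) + c zero * det M)
      ≡⟨ cong (λ t → ∏ (c ∘ suc) * (t + c zero * det M))
          (laplace-vanish (λ _ → 0ℤ) (minors (M ∘ suc)) λ _ → refl) ⟩
    ∏ (c ∘ suc) * (0ℤ + c zero * det M)
      ≡⟨ regroup (∏ (c ∘ suc)) (c zero) (det M) ⟩
    c zero * ∏ (c ∘ suc) * det M ∎
    where
    regroup : ∀ p c d → p * (0ℤ + c * d) ≡ c * p * d
    regroup = solve-∀

-- Integrality from bounded denominators of powers.

module Powers where

  open import Data.Nat using (zero; suc; _+_; _*_; _^_; _<_; NonZero; ≢-nonZero; ≢-nonZero⁻¹; s≤s; z≤n)
  open import Data.Nat.Properties
  open import Data.Nat.Divisibility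
  open import Data.Nat.DivMod using (_/_; m/n*n≡m)
  open import Data.Nat.GCD using (gcd; gcd[m,n]∣m; gcd[m,n]∣n)
  open import Data.Nat.Coprimality using (Coprime; coprime-divisor; coprime-/gcd)
  import Data.Nat.Coprimality as Coprimality
  open import Data.Nat.Tactic.RingSolver using (solve-∀)
  open import Data.Integer as ℤ using (ℤ; ∣_∣)
  import Data.Integer.Properties as ℤₚ
  import Data.Integer.Divisibility.Signed as ℤ∣
  open import Data.Product using (_,_)
  open import Relation.Binary.PropositionalEquality
  open import Relation.Nullary using (contradiction)

  ^-distribʳ-* : ∀ m n k → (m * n) ^ k ≡ m ^ k * n ^ k
  ^-distribʳ-* m n zero    = refl
  ^-distribʳ-* m n (suc k) = trans (cong (m * n *_) (^-distribʳ-* m n k)) (interchange m n (m ^ k) (n ^ k))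
    where
    interchange : ∀ a b c d → a * b * (c * d) ≡ a * c * (b * d)
    interchange = solve-∀

  coprime-*ˡ : ∀ {a b u} → Coprime a u → Coprime b u → Coprime (a * b) u
  coprime-*ˡ {a} {b} a⊥u b⊥u {d} (d∣ab , d∣u) =
    b⊥u (coprime-divisor {n = a} (λ { (e∣d , e∣a) → a⊥u (e∣a , ∣-trans e∣d d∣u) }) d∣ab , d∣u)

  coprime-^ˡ : ∀ {a u} m → Coprime a u → Coprime (a ^ m) u
  coprime-^ˡ zero    a⊥u = Coprimality.1-coprimeTo _
  coprime-^ˡ {a} (suc m) a⊥u = coprime-*ˡ {a} a⊥u (coprime-^ˡ m a⊥u)

  coprime-^-divisor : ∀ {d u c} m → Coprime d u → d ∣ u ^ m * c → d ∣ c
  coprime-^-divisor {d} {u} {c} zero    d⊥u d∣ = subst (d ∣_) (*-identityˡ c) d∣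
  coprime-^-divisor {d} {u} {c} (suc m) d⊥u d∣ =
    coprime-^-divisor m d⊥u (coprime-divisor {n = u} d⊥u (subst (d ∣_) (*-assoc u (u ^ m) c) d∣))

  n<[2+d]^n : ∀ d n → n < suc (suc d) ^ n
  n<[2+d]^n d zero    = s≤s z≤n
  n<[2+d]^n d (suc n) = begin-strict
    suc n                                             ≤⟨ n<[2+d]^n d n ⟩
    suc (suc d) ^ n                                   <⟨ m<n+m _ (m^n>0 (suc (suc d)) n) ⟩
    suc (suc d) ^ n + suc (suc d) ^ n                 ≤⟨ +-monoʳ-≤ (suc (suc d) ^ n)
        (m≤m+n (suc (suc d) ^ n) _) ⟩
    suc (suc d) ^ suc n                               ∎
    where open ≤-Reasoning

  -- For d at least 2 the single exponent m = c is contradictory, since d ^ c exceeds c.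
  powers-∣⇒≡1 : ∀ d c .{{_ : NonZero d}} .{{_ : NonZero c}} → (∀ m → d ^ m ∣ c) → d ≡ 1
  powers-∣⇒≡1 (suc zero)    c d^∣c = refl
  powers-∣⇒≡1 (suc (suc d)) c d^∣c = contradiction (n<[2+d]^n d c) (≤⇒≯ (∣⇒≤ (d^∣c c)))

  -- A rational u / d whose powers have a common denominator c is an integer.
  powers-∣⇒∣ : ∀ d u c .{{_ : NonZero d}} .{{_ : NonZero c}} → (∀ m → d ^ m ∣ u ^ m * c) → d ∣ u
  powers-∣⇒∣ d u c d^∣u^c = subst (_∣ u) (trans (sym (trans (cong (_* g) d′≡1) (*-identityˡ g))) d′g≡d)
      (gcd[m,n]∣n d u)
    where
    g = gcd d u
    instance
      g≢0 : NonZero g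
      g≢0 = ≢-nonZero λ g≡0 → ≢-nonZero⁻¹ d (0∣⇒≡0 (subst (_∣ d) g≡0 (gcd[m,n]∣m d u)))
    d′ = d / g
    u′ = u / g
    d′g≡d : d′ * g ≡ d
    d′g≡d = m/n*n≡m (gcd[m,n]∣m d u)
    u′g≡u : u′ * g ≡ u
    u′g≡u = m/n*n≡m (gcd[m,n]∣n d u)
    instance
      d′≢0 : NonZero d′
      d′≢0 = ≢-nonZero λ d′≡0 → ≢-nonZero⁻¹ d (trans (sym d′g≡d) (cong (_* g) d′≡0))
    swap : ∀ a b c → a * b * c ≡ b * (a * c)
    swap = solve-∀
    -- After the common factor `g ^ m` is removed, `d′ ^ m` is coprime to `u′`, so it has to divide
    -- the constant `c`.
    d′^∣c : ∀ m → d′ ^ m ∣ c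
    d′^∣c m = coprime-^-divisor m (coprime-^ˡ m (coprime-/gcd d u))
        (*-cancelˡ-∣ (g ^ m) {{m^n≢0 g m}} (subst₂ _∣_
      (trans (cong (_^ m) (sym d′g≡d)) (trans (^-distribʳ-* d′ g m) (*-comm (d′ ^ m) (g ^ m))))
      (trans (cong (λ t → t ^ m * c) (sym u′g≡u)) (trans (cong (_* c) (^-distribʳ-* u′ g m))
          (swap (u′ ^ m) (g ^ m) c)))
      (d^∣u^c m)))
    d′≡1 : d′ ≡ 1
    d′≡1 = powers-∣⇒≡1 d′ c d′^∣c

  abs-^ : ∀ i m → ∣ i ℤ.^ m ∣ ≡ ∣ i ∣ ^ m
  abs-^ i zero    = refl
  abs-^ i (suc m) = trans (ℤₚ.abs-* i (i ℤ.^ m)) (cong (∣ i ∣ *_) (abs-^ i m))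

  powers-∣⇒∣ℤ : ∀ d u c .{{_ : ℤ.NonZero d}} .{{_ : ℤ.NonZero c}} →
      (∀ m → d ℤ.^ m ℤ∣.∣ u ℤ.^ m ℤ.* c) → d ℤ∣.∣ u
  powers-∣⇒∣ℤ d u c d^∣u^c = ℤ∣.∣ᵤ⇒∣ (powers-∣⇒∣ (∣ d ∣) (∣ u ∣) (∣ c ∣) λ m →
    subst₂ _∣_ (abs-^ d m) (trans (ℤₚ.abs-* (u ℤ.^ m) c) (cong (_* ∣ c ∣) (abs-^ u m))) (ℤ∣.∣⇒∣ᵤ (d^∣u^c m)))

-- Elementary symmetric functions and scaled binomial coefficients.

module SymmetricFunctions where

  open import Data.Nat as ℕ using (ℕ; zero; suc; s≤s; z≤n; _!)
  import Data.Nat.Properties as ℕₚ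
  open import Data.Nat.Combinatorics using (_C_; nCk+nC[k+1]≡[n+1]C[k+1]; k>n⇒nCk≡0; nC1≡n)
  open import Data.Integer using (ℤ; +_; -_; _+_; _*_; _-_; _^_; 0ℤ; 1ℤ)
  open import Data.Integer.Properties
  open import Data.Integer.Tactic.RingSolver using (solve-∀)
  import Data.Nat.Tactic.RingSolver as ℕ-Solver
  open import Data.Fin using (Fin; zero; suc; toℕ; inject₁; fromℕ)
  import Data.Fin.Properties as Finₚ
  open import Data.Vec as Vec using (Vec; []; _∷_)
  open import Data.Vec.Functional using (Vector)
  open import Relation.Binary.PropositionalEquality
  open import Function using (_∘_)
  open import Data.Product using (∃; _,_)
  open import Relation.Nullary using (yes; no)
  open Sums
  open Determinant using (∏)

  open ≡-Reasoning

  esym : ∀ {n} → Vec ℤ n → ℕ → ℤ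
  esym xs       zero    = 1ℤ
  esym []       (suc k) = 0ℤ
  esym (x ∷ xs) (suc k) = esym xs (suc k) + x * esym xs k

  esym-zero : ∀ {n} (xs : Vec ℤ n) {k} → n ℕ.< k → esym xs k ≡ 0ℤ
  esym-zero []       (s≤s z≤n)       = refl
  esym-zero (x ∷ xs) {suc k} (s≤s n<k) = begin
    esym xs (suc k) + x * esym xs k ≡⟨ cong₂ (λ a b → a + x * b) (esym-zero xs (ℕₚ.m≤n⇒m≤1+n n<k))
        (esym-zero xs n<k) ⟩
    0ℤ + x * 0ℤ               ≡⟨ trans (+-identityˡ _) (*-zeroʳ x) ⟩
    0ℤ                        ∎

  -- For j ≤ n this is the binomial coefficient C(n-j, k-j); the remaining values
  -- are immaterial and chosen to keep the recursion free of subtraction.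
  shiftCoeff : ℕ → ℕ → ℕ → ℤ
  shiftCoeff n       zero    zero    = 1ℤ
  shiftCoeff n       zero    (suc j) = 0ℤ
  shiftCoeff zero    (suc k) zero    = 0ℤ
  shiftCoeff zero    (suc k) (suc j) = shiftCoeff zero k j
  shiftCoeff (suc n) (suc k) zero    = shiftCoeff n (suc k) zero + shiftCoeff n k zero
  shiftCoeff (suc n) (suc k) (suc j) = shiftCoeff n k j

  shiftCoeff-pascal : ∀ n k j → j ℕ.≤ n →
    shiftCoeff (suc n) (suc k) j ≡ shiftCoeff n (suc k) j + shiftCoeff n k j
  shiftCoeff-pascal n       k       zero          j≤n       = refl
  shiftCoeff-pascal (suc n) (suc k) (suc j)       (s≤s j≤n) = shiftCoeff-pascal n k j j≤n
  shiftCoeff-pascal (suc n) zero    (suc zero)    (s≤s j≤n) = refl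
  shiftCoeff-pascal (suc n) zero    (suc (suc j)) (s≤s j≤n) = refl

  shiftCoeff-diag : ∀ n k → shiftCoeff n k k ≡ 1ℤ
  shiftCoeff-diag n       zero    = refl
  shiftCoeff-diag zero    (suc k) = shiftCoeff-diag zero k
  shiftCoeff-diag (suc n) (suc k) = shiftCoeff-diag n k

  shiftCoeff-upper : ∀ n {k j} → k ℕ.< j → shiftCoeff n k j ≡ 0ℤ
  shiftCoeff-upper n       {zero}  {suc j} k<j       = refl
  shiftCoeff-upper zero    {suc k} {suc j} (s≤s k<j) = shiftCoeff-upper zero k<j
  shiftCoeff-upper (suc n) {suc k} {suc j} (s≤s k<j) = shiftCoeff-upper n k<j

  -- Expand each product of k factors 1 + xᵢ over the subsets of its index set: a given j-set lies
  -- in C(n-j, k-j) sets of size k. Any `s` above `k` gives the same sum because the coefficients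
  -- vanish for j > k.
  esym-shift : ∀ {n} (xs : Vec ℤ n) s k → k ℕ.< s →
    ∑ (λ (j : Fin s) → shiftCoeff n k (toℕ j) * esym xs (toℕ j)) ≡ esym (Vec.map (λ x → 1ℤ + x) xs) k
  esym-shift xs (suc s) zero k<s = begin
    ∑ (λ j → shiftCoeff _ zero (toℕ j) * esym xs (toℕ j))
      ≡⟨ ∑-suc _ ⟩
    1ℤ * 1ℤ + ∑ (λ j → 0ℤ * esym xs (suc (toℕ j)))
      ≡⟨ cong (λ t → 1ℤ * 1ℤ + t) (∑-zero {f = λ (j : Fin s) → 0ℤ * esym xs (suc (toℕ j))} λ j → *-zeroˡ
          (esym xs (suc (toℕ j)))) ⟩
    1ℤ ∎
  esym-shift [] (suc s) (suc k) (s≤s k<s) = begin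
    ∑ (λ j → shiftCoeff zero (suc k) (toℕ j) * esym [] (toℕ j))
      ≡⟨ ∑-suc _ ⟩
    0ℤ * 1ℤ + ∑ (λ j → shiftCoeff zero k (toℕ j) * 0ℤ)
      ≡⟨ cong (λ t → 0ℤ * 1ℤ + t) (∑-zero {f = λ (j : Fin s) → shiftCoeff zero k (toℕ j) * 0ℤ} λ j → *-zeroʳ
          (shiftCoeff zero k (toℕ j))) ⟩
    0ℤ ∎
  esym-shift {suc n} (x ∷ xs) (suc s) (suc k) (s≤s k<s) = begin
    ∑ (λ j → a (toℕ j) * esym (x ∷ xs) (toℕ j))
      ≡⟨ ∑-suc _ ⟩
    a 0 * 1ℤ + ∑ (λ j → a (suc (toℕ j)) * (esym xs (suc (toℕ j)) + x * esym xs (toℕ j)))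
      ≡⟨ cong (λ t → a 0 * 1ℤ + t) (trans (∑-cong λ j → distrib (a (suc (toℕ j))) (esym xs (suc (toℕ j))) x
          (esym xs (toℕ j))) (trans (∑-+ (λ j → a (suc (toℕ j)) * esym xs (suc (toℕ j))) _)
          (cong (λ t → ∑ (λ j → a (suc (toℕ j)) * esym xs (suc (toℕ j))) + t) (sym (∑-*ˡ x _))))) ⟩
    a 0 * 1ℤ + (∑ (λ j → a (suc (toℕ j)) * esym xs (suc (toℕ j))) + x * ∑
        (λ j → shiftCoeff n k (toℕ j) * esym xs (toℕ j)))
      ≡⟨ +-assoc (a 0 * 1ℤ) _ _ ⟨
    a 0 * 1ℤ + ∑ (λ j → a (suc (toℕ j)) * esym xs (suc (toℕ j))) + x * ∑
        (λ j → shiftCoeff n k (toℕ j) * esym xs (toℕ j))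
      ≡⟨ cong₂ _+_ (sym (∑-suc _)) (cong (x *_) (esym-shift xs s k k<s)) ⟩
    ∑ (λ j → a (toℕ j) * esym xs (toℕ j)) + x * e k
      ≡⟨ cong (_+ x * e k) (∑-cong {f = λ (j : Fin (suc s)) → a (toℕ j) * esym xs (toℕ j)} λ j → pascal
          (toℕ j)) ⟩
    ∑ (λ j → shiftCoeff n (suc k) (toℕ j) * esym xs (toℕ j) + shiftCoeff n k (toℕ j) * esym xs
        (toℕ j)) + x * e k
      ≡⟨ cong (_+ x * e k) (trans (∑-+ _ _) (cong₂ _+_ (esym-shift xs (suc s) (suc k) (s≤s k<s))
          (esym-shift xs (suc s) k (ℕₚ.m≤n⇒m≤1+n k<s)))) ⟩
    e (suc k) + e k + x * e k
      ≡⟨ collect (e (suc k)) (e k) x ⟩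
    e (suc k) + (1ℤ + x) * e k ∎
    where
    a : ℕ → ℤ
    a = shiftCoeff (suc n) (suc k)
    e : ℕ → ℤ
    e = esym (Vec.map (λ x → 1ℤ + x) xs)
    distrib : ∀ a f x e → a * (f + x * e) ≡ a * f + x * (a * e)
    distrib = solve-∀
    collect : ∀ f e x → f + e + x * e ≡ f + (1ℤ + x) * e
    collect = solve-∀
    -- The Pascal rule for `shiftCoeff` is available only for j ≤ n; beyond that `esym xs j`
    -- vanishes and makes up for it.
    pascal : ∀ j → a j * esym xs j ≡ shiftCoeff n (suc k) j * esym xs j + shiftCoeff n k j * esym xs j
    pascal j with j ℕ.≤? n
    ... | yes j≤n = trans (cong (_* esym xs j) (shiftCoeff-pascal n k j j≤n))
        (*-distribʳ-+ (esym xs j) (shiftCoeff n (suc k) j) _)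
    ... | no  j≰n rewrite esym-zero xs (ℕₚ.≰⇒> j≰n) = trans (*-zeroʳ (a j))
        (sym (cong₂ _+_ (*-zeroʳ (shiftCoeff n (suc k) j)) (*-zeroʳ (shiftCoeff n k j))))

  esym-replicate-nonneg : ∀ c n k → ∃ λ e → esym (Vec.replicate n (+ c)) k ≡ + e
  esym-replicate-nonneg c n       zero    = 1 , refl
  esym-replicate-nonneg c zero    (suc k) = 0 , refl
  esym-replicate-nonneg c (suc n) (suc k) with esym-replicate-nonneg c n (suc k) | esym-replicate-nonneg c n k
  ... | e , eq | f , eq′ = e ℕ.+ c ℕ.* f , (begin
    esym (Vec.replicate n (+ c)) (suc k) + + c * esym (Vec.replicate n (+ c)) k ≡⟨ cong₂
        (λ a b → a + + c * b) eq eq′ ⟩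
    + e + + c * + f                                                             ≡⟨ cong (λ t → + e + t)
        (pos-* c f) ⟨
    + e + + (c ℕ.* f)                                                           ≡⟨ pos-+ e (c ℕ.* f) ⟨
    + (e ℕ.+ c ℕ.* f)                                                           ∎)

  -- This yields the nonvanishing of the diagonal kernel values, which are elementary symmetric
  -- functions of n copies of the alphabet size minus one.
  esym-replicate-pos : ∀ c n k → k ℕ.≤ n → ∃ λ e → esym (Vec.replicate n (+ suc c)) k ≡ + suc e
  esym-replicate-pos c n       zero    k≤n       = 0 , refl
  esym-replicate-pos c (suc n) (suc k) (s≤s k≤n) with esym-replicate-nonneg (suc c) n
      (suc k) | esym-replicate-pos c n k k≤n
  ... | e , eq | f , eq′ = f ℕ.+ c ℕ.* suc f ℕ.+ e , (begin
    esym (Vec.replicate n (+ suc c)) (suc k) + + suc c * esym (Vec.replicate n (+ suc c)) k ≡⟨ cong₂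
        (λ a b → a + + suc c * b) eq eq′ ⟩
    + e + + suc c * + suc f                                                                 ≡⟨ cong
        (λ t → + e + t) (pos-* (suc c) (suc f)) ⟨
    + e + + (suc c ℕ.* suc f)                                                               ≡⟨ +-comm (+ e)
        (+ (suc c ℕ.* suc f)) ⟩
    + (suc c ℕ.* suc f ℕ.+ e)                                                               ∎)

  -- This is the k-th elementary symmetric function of x entries `q` together with any number of
  -- zeros; `scaledBinom-suc` is the `esym` recursion at an entry `q`.
  scaledBinom : ℕ → ℕ → ℕ → ℤ
  scaledBinom q x k = (+ q) ^ k * + (x C k)

  scaledBinom-suc : ∀ q x k → scaledBinom q (suc x) (suc k) ≡ scaledBinom q x (suc k) + + q * scaledBinom q x k
  scaledBinom-suc q x k = begin
    (+ q) ^ suc k * + (suc x C suc k)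
      ≡⟨ cong (λ t → (+ q) ^ suc k * + t) (nCk+nC[k+1]≡[n+1]C[k+1] x k) ⟨
    (+ q) ^ suc k * + (x C k ℕ.+ x C suc k)
      ≡⟨ cong ((+ q) ^ suc k *_) (pos-+ (x C k) (x C suc k)) ⟩
    (+ q * (+ q) ^ k) * (+ (x C k) + + (x C suc k))
      ≡⟨ expand (+ q) ((+ q) ^ k) (+ (x C k)) (+ (x C suc k)) ⟩
    scaledBinom q x (suc k) + + q * scaledBinom q x k ∎
    where
    expand : ∀ q p a b → q * p * (a + b) ≡ q * p * b + q * (p * a)
    expand = solve-∀

  -- Both sides count pairs of a k-subset and an element: the element lies outside the subset in the
  -- first summand and inside it in the second.
  C-absorb : ∀ x k → x ℕ.* (x C k) ≡ suc k ℕ.* (x C suc k) ℕ.+ k ℕ.* (x C k)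
  C-absorb zero zero = refl
  C-absorb zero (suc k) = sym (cong₂ ℕ._+_ (vanish (suc (suc k)) (suc k)) (vanish (suc k) k))
    where
    vanish : ∀ m k → m ℕ.* (0 C suc k) ≡ 0
    vanish m k = trans (cong (m ℕ.*_) (k>n⇒nCk≡0 {0} {suc k} (s≤s z≤n))) (ℕₚ.*-zeroʳ m)
  C-absorb (suc x) zero = begin
    suc x ℕ.* 1                            ≡⟨ ℕₚ.*-identityʳ (suc x) ⟩
    suc x                                  ≡⟨ nC1≡n (suc x) ⟨
    suc x C 1                              ≡⟨ trans (ℕₚ.+-identityʳ _) (ℕₚ.*-identityˡ (suc x C 1)) ⟨
    1 ℕ.* (suc x C 1) ℕ.+ 0 ℕ.* (suc x C 0) ∎
  C-absorb (suc x) (suc k) = begin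
    suc x ℕ.* (suc x C suc k)
      ≡⟨ cong (suc x ℕ.*_) (nCk+nC[k+1]≡[n+1]C[k+1] x k) ⟨
    suc x ℕ.* (x C k ℕ.+ x C suc k)
      ≡⟨ split x (x C k) (x C suc k) ⟩
    x ℕ.* (x C k) ℕ.+ x ℕ.* (x C suc k) ℕ.+ (x C k ℕ.+ x C suc k)
      ≡⟨ cong₂ (λ a b → a ℕ.+ b ℕ.+ (x C k ℕ.+ x C suc k)) (C-absorb x k) (C-absorb x (suc k)) ⟩
    (suc k ℕ.* (x C suc k) ℕ.+ k ℕ.* (x C k)) ℕ.+ (suc (suc k) ℕ.* (x C suc (suc k)) ℕ.+ suc k ℕ.*
        (x C suc k)) ℕ.+ (x C k ℕ.+ x C suc k)
      ≡⟨ merge k (x C k) (x C suc k) (x C suc (suc k)) ⟩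
    suc (suc k) ℕ.* (x C suc k ℕ.+ x C suc (suc k)) ℕ.+ suc k ℕ.* (x C k ℕ.+ x C suc k)
      ≡⟨ cong₂ (λ a b → suc (suc k) ℕ.* a ℕ.+ suc k ℕ.* b) (nCk+nC[k+1]≡[n+1]C[k+1] x (suc k))
          (nCk+nC[k+1]≡[n+1]C[k+1] x k) ⟩
    suc (suc k) ℕ.* (suc x C suc (suc k)) ℕ.+ suc k ℕ.* (suc x C suc k) ∎
    where
    split : ∀ x a b → suc x ℕ.* (a ℕ.+ b) ≡ x ℕ.* a ℕ.+ x ℕ.* b ℕ.+ (a ℕ.+ b)
    split = ℕ-Solver.solve-∀
    merge : ∀ k a b c → (suc k ℕ.* b ℕ.+ k ℕ.* a) ℕ.+ (suc (suc k) ℕ.* c ℕ.+ suc k ℕ.* b) ℕ.+ (a ℕ.+ b) ≡ suc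
        (suc k) ℕ.* (b ℕ.+ c) ℕ.+ suc k ℕ.* (a ℕ.+ b)
    merge = ℕ-Solver.solve-∀

  -- In this basis, multiplication by `q x` moves the index up by at most one, with integer
  -- coefficients. The recursion of `binomCoeff` records exactly this.
  scaledBinom-* : ∀ q x k → + q * + x * scaledBinom q x k ≡ + suc k * scaledBinom q x
      (suc k) + + q * + k * scaledBinom q x k
  scaledBinom-* q x k = begin
    + q * + x * ((+ q) ^ k * + (x C k))
      ≡⟨ pull (+ q) (+ x) ((+ q) ^ k) (+ (x C k)) ⟩
    + q * (+ q) ^ k * (+ x * + (x C k))
      ≡⟨ cong (+ q * (+ q) ^ k *_) absorb ⟩
    + q * (+ q) ^ k * (+ suc k * + (x C suc k) + + k * + (x C k))
      ≡⟨ push (+ q) ((+ q) ^ k) (+ suc k) (+ (x C suc k)) (+ k) (+ (x C k)) ⟩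
    + suc k * scaledBinom q x (suc k) + + q * + k * scaledBinom q x k ∎
    where
    pull : ∀ q x p c → q * x * (p * c) ≡ q * p * (x * c)
    pull = solve-∀
    push : ∀ q p k′ c′ k c → q * p * (k′ * c′ + k * c) ≡ k′ * (q * p * c′) + q * k * (p * c)
    push = solve-∀
    absorb : + x * + (x C k) ≡ + suc k * + (x C suc k) + + k * + (x C k)
    absorb = begin
      + x * + (x C k)
        ≡⟨ pos-* x (x C k) ⟨
      + (x ℕ.* (x C k))
        ≡⟨ cong +_ (C-absorb x k) ⟩
      + (suc k ℕ.* (x C suc k) ℕ.+ k ℕ.* (x C k))
        ≡⟨ pos-+ (suc k ℕ.* (x C suc k)) (k ℕ.* (x C k)) ⟩
      + (suc k ℕ.* (x C suc k)) + + (k ℕ.* (x C k))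
        ≡⟨ cong₂ _+_ (pos-* (suc k) (x C suc k)) (pos-* k (x C k)) ⟩
      + suc k * + (x C suc k) + + k * + (x C k) ∎

  -- The coefficients of q ^ k ∏ (x - aᵢ) in the basis scaledBinom q x.
  binomCoeff : ℕ → ∀ {k} → Vector ℤ k → ℕ → ℤ
  binomCoeff q {zero}  a zero    = 1ℤ
  binomCoeff q {zero}  a (suc i) = 0ℤ
  binomCoeff q {suc k} a zero    = + q * (0ℤ - a zero) * binomCoeff q (a ∘ suc) zero
  binomCoeff q {suc k} a (suc i) = + suc i * binomCoeff q (a ∘ suc) i + + q * (+ suc i - a zero) * binomCoeff q
      (a ∘ suc) (suc i)

  binomCoeff-upper : ∀ q {k} (a : Vector ℤ k) {i} → k ℕ.< i → binomCoeff q a i ≡ 0ℤ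
  binomCoeff-upper q {zero}  a {suc i} k<i       = refl
  binomCoeff-upper q {suc k} a {suc i} (s≤s k<i) = begin
    + suc i * binomCoeff q (a ∘ suc) i + + q * (+ suc i - a zero) * binomCoeff q (a ∘ suc) (suc i)
      ≡⟨ cong₂ (λ u v → + suc i * u + + q * (+ suc i - a zero) * v) (binomCoeff-upper q (a ∘ suc) k<i)
          (binomCoeff-upper q (a ∘ suc) (ℕₚ.m≤n⇒m≤1+n k<i)) ⟩
    + suc i * 0ℤ + + q * (+ suc i - a zero) * 0ℤ
      ≡⟨ cong₂ _+_ (*-zeroʳ (+ suc i)) (*-zeroʳ (+ q * (+ suc i - a zero))) ⟩
    0ℤ ∎

  -- Comparison of leading terms: q^k x^k is k! times the leading term of q^k C(x,k). The
  -- superfactorial of the theorem originates here.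
  binomCoeff-diag : ∀ q {k} (a : Vector ℤ k) → binomCoeff q a k ≡ + (k !)
  binomCoeff-diag q {zero}  a = refl
  binomCoeff-diag q {suc k} a = begin
    + suc k * binomCoeff q (a ∘ suc) k + + q * (+ suc k - a zero) * binomCoeff q (a ∘ suc) (suc k)
      ≡⟨ cong₂ (λ u v → + suc k * u + + q * (+ suc k - a zero) * v) (binomCoeff-diag q (a ∘ suc))
          (binomCoeff-upper q (a ∘ suc) ℕₚ.≤-refl) ⟩
    + suc k * + (k !) + + q * (+ suc k - a zero) * 0ℤ
      ≡⟨ trans (cong (λ t → + suc k * + (k !) + t) (*-zeroʳ (+ q * (+ suc k - a zero)))) (+-identityʳ _) ⟩
    + suc k * + (k !)
      ≡⟨ pos-* (suc k) (k !) ⟨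
    + (suc k !) ∎

  binomCoeff-expand : ∀ q {k} (a : Vector ℤ k) s x → k ℕ.< s →
    (+ q) ^ k * ∏ (λ i → + x - a i) ≡ ∑ λ (i : Fin s) → binomCoeff q a (toℕ i) * scaledBinom q x (toℕ i)
  binomCoeff-expand q {zero} a (suc s) x k<s = sym (begin
    ∑ (λ i → binomCoeff q a (toℕ i) * scaledBinom q x (toℕ i))
      ≡⟨ ∑-suc _ ⟩
    1ℤ + ∑ (λ i → 0ℤ * scaledBinom q x (suc (toℕ i)))
      ≡⟨ cong (λ t → 1ℤ + t) (∑-zero {f = λ (i : Fin s) → 0ℤ * scaledBinom q x (suc (toℕ i))} λ i → *-zeroˡ
          (scaledBinom q x (suc (toℕ i)))) ⟩
    1ℤ ∎)
  binomCoeff-expand q {suc k} a (suc s) x (s≤s k<s) = begin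
    + q * (+ q) ^ k * ((+ x - a zero) * ∏ (λ i → + x - a (suc i)))
      ≡⟨ regroup (+ q) ((+ q) ^ k) (+ x - a zero) (∏ (λ i → + x - a (suc i))) ⟩
    + q * (+ x - a zero) * ((+ q) ^ k * ∏ (λ i → + x - a (suc i)))
      ≡⟨ cong (+ q * (+ x - a zero) *_) (binomCoeff-expand q (a ∘ suc) (suc s) x (ℕₚ.m≤n⇒m≤1+n k<s)) ⟩
    + q * (+ x - a zero) * ∑ (λ i → τ (toℕ i) * β (toℕ i))
      ≡⟨ ∑-*ˡ (+ q * (+ x - a zero)) _ ⟩
    ∑ (λ i → + q * (+ x - a zero) * (τ (toℕ i) * β (toℕ i)))
      -- By `scaledBinom-*` each basis element either rises by one index (`up`) or keeps its index
      -- (`level`).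
      ≡⟨ ∑-cong (λ i → term (toℕ i)) ⟩
    ∑ (λ i → up (toℕ i) + level (toℕ i))
      ≡⟨ ∑-+ _ _ ⟩
    ∑ (λ i → up (toℕ i)) + ∑ (λ i → level (toℕ i))
      ≡⟨ cong₂ _+_ drop-last (∑-suc _) ⟩
    ∑ (λ i → up (toℕ i)) + (level 0 + ∑ (λ i → level (suc (toℕ i))))
      ≡⟨ rotate (∑ (λ i → up (toℕ i))) (level 0) (∑ (λ i → level (suc (toℕ i)))) ⟩
    level 0 + (∑ (λ i → up (toℕ i)) + ∑ (λ i → level (suc (toℕ i))))
      ≡⟨ cong (λ t → level 0 + t) (∑-+ (λ i → up (toℕ i)) _) ⟨
    level 0 + ∑ (λ i → up (toℕ i) + level (suc (toℕ i)))
      ≡⟨ cong₂ _+_ (sym (*-assoc (+ q * (0ℤ - a zero)) (τ 0) (β 0) ))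
          (∑-cong λ i → collect (+ suc (toℕ i)) (τ (toℕ i)) (β (suc (toℕ i))) (+ q * (+ suc (toℕ i) - a zero))
          (τ (suc (toℕ i)))) ⟩
    binomCoeff q a 0 * β 0 + ∑ (λ i → binomCoeff q a (suc (toℕ i)) * β (suc (toℕ i)))
      ≡⟨ ∑-suc _ ⟨
    ∑ (λ i → binomCoeff q a (toℕ i) * β (toℕ i)) ∎
    where
    τ β up level : ℕ → ℤ
    τ = binomCoeff q (a ∘ suc)
    β = scaledBinom q x
    up i = + suc i * τ i * β (suc i)
    level i = + q * (+ i - a zero) * (τ i * β i)
    regroup : ∀ q p y r → q * p * (y * r) ≡ q * y * (p * r)
    regroup = solve-∀
    rotate : ∀ u v w → u + (v + w) ≡ v + (u + w)
    rotate = solve-∀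
    collect : ∀ i t b l t′ → i * t * b + l * (t′ * b) ≡ (i * t + l * t′) * b
    collect = solve-∀
    term : ∀ i → + q * (+ x - a zero) * (τ i * β i) ≡ up i + level i
    term i = begin
      + q * (+ x - a zero) * (τ i * β i)
        ≡⟨ expose (+ q) (+ x) (a zero) (τ i) (β i) ⟩
      τ i * (+ q * + x * β i) - + q * a zero * (τ i * β i)
        ≡⟨ cong (λ t → τ i * t - + q * a zero * (τ i * β i)) (scaledBinom-* q x i) ⟩
      τ i * (+ suc i * β (suc i) + + q * + i * β i) - + q * a zero * (τ i * β i)
        ≡⟨ finish (τ i) (+ suc i) (β (suc i)) (+ q) (+ i) (β i) (a zero) ⟩
      up i + level i ∎
      where
      expose : ∀ q x a t b → q * (x - a) * (t * b) ≡ t * (q * x * b) - q * a * (t * b)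
      expose = solve-∀
      finish : ∀ t j b′ q i b a → t * (j * b′ + q * i * b) - q * a * (t * b) ≡ j * t * b′ + q * (i - a) *
          (t * b)
      finish = solve-∀
    -- At index `s` the coefficient `τ s` is zero because k < s, so reindexing the `up` terms by one
    -- loses nothing.
    drop-last : ∑ (λ (i : Fin (suc s)) → up (toℕ i)) ≡ ∑ (λ (i : Fin s) → up (toℕ i))
    drop-last = begin
      ∑ (λ i → up (toℕ i))
        ≡⟨ ∑-init-last _ ⟩
      ∑ (λ i → up (toℕ (inject₁ i))) + up (toℕ (fromℕ s))
        ≡⟨ cong₂ _+_ (∑-cong λ i → cong up (Finₚ.toℕ-inject₁ i))
            (trans (cong up (Finₚ.toℕ-fromℕ s)) (trans
            (cong (λ t → + suc s * t * β (suc s)) (binomCoeff-upper q (a ∘ suc) k<s))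
            (cong (_* β (suc s)) (*-zeroʳ (+ suc s))))) ⟩
      ∑ (λ i → up (toℕ i)) + 0ℤ
        ≡⟨ +-identityʳ _ ⟩
      ∑ (λ i → up (toℕ i)) ∎

-- The determinant of the scaled binomial matrix as a Vandermonde quotient.

module Vandermonde where

  open import Defs using (superfact)
  open import Data.Nat as ℕ using (ℕ; zero; suc; _!)
  import Data.Nat.Properties as ℕₚ
  open import Data.Nat.DivMod using (_/_; m*n/n≡m)
  open import Data.Integer using (ℤ; +_; -_; _+_; _*_; _-_; _^_; 0ℤ; 1ℤ)
  open import Data.Integer.Properties
  open import Data.Integer.Tactic.RingSolver using (solve-∀)
  import Data.Nat.Tactic.RingSolver as ℕ-Solver
  open import Data.Fin as F using (Fin; zero; suc; toℕ; inject; inject₁; fromℕ; fromℕ<; _<_)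
  import Data.Fin.Properties as Finₚ
  open import Data.Bool using (if_then_else_)
  open import Data.Vec.Functional using (Vector)
  open import Relation.Binary.PropositionalEquality
  open import Relation.Nullary.Decidable using (⌊_⌋; isYes≗does)
  open import Function using (_∘_)
  open Determinant
  open SymmetricFunctions

  open ≡-Reasoning

  ∏-init-last : ∀ {n} (f : Vector ℤ (suc n)) → ∏ f ≡ ∏ (f ∘ inject₁) * f (fromℕ n)
  ∏-init-last {zero}  f = *-comm (f zero) 1ℤ
  ∏-init-last {suc n} f = trans (cong (f zero *_) (∏-init-last (f ∘ suc))) (sym (*-assoc (f zero) _ _))

  ∏-zero : ∀ {n} (f : Vector ℤ n) k → f k ≡ 0ℤ → ∏ f ≡ 0ℤ
  ∏-zero f zero    fk≡0 = cong (_* ∏ (f ∘ suc)) fk≡0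
  ∏-zero f (suc k) fk≡0 = trans (cong (f zero *_) (∏-zero (f ∘ suc) k fk≡0)) (*-zeroʳ (f zero))

  -- Row k is the k-th Newton polynomial on the nodes `x`, column l its value at node l; `inject`
  -- runs through the indices below k. Evaluated at its own nodes this basis is triangular, so the
  -- Vandermonde product appears on the diagonal.
  newton : ∀ {s} → Vector ℤ s → Matrix s s
  newton x k l = ∏ {toℕ k} λ m → x l - x (inject {i = k} m)

  newton-lower : ∀ {s} (x : Vector ℤ s) {k l} → l < k → newton x k l ≡ 0ℤ
  newton-lower x {k} {l} l<k = ∏-zero (λ m → x l - x (inject {i = k} m)) (fromℕ< l<k)
    (trans (cong (λ i → x l - x i) inject≡l) (+-inverseʳ (x l)))
    where
    inject≡l : inject {i = k} (fromℕ< l<k) ≡ l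
    inject≡l = Finₚ.toℕ-injective (trans (Finₚ.toℕ-inject (fromℕ< l<k)) (Finₚ.toℕ-fromℕ< l<k))

  -- The orientation is opposite to that of `vandermonde`; the reflection from distances to numbers
  -- of agreements reverses it again.
  differences : ∀ {s} → Vector ℤ s → ℤ
  differences x = ∏ λ i → ∏ λ j → if ⌊ i F.<? j ⌋ then (x j - x i) else 1ℤ

  ∏-newton-diag : ∀ {s} (x : Vector ℤ s) → ∏ (λ k → newton x k k) ≡ differences x
  ∏-newton-diag {zero}  x = refl
  ∏-newton-diag {suc s} x = begin
    1ℤ * ∏ (λ k → (x (suc k) - x zero) * newton (x ∘ suc) k k)
      ≡⟨ cong (1ℤ *_) (trans (∏-* (λ k → x (suc k) - x zero) (λ k → newton (x ∘ suc) k k))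
          (cong (∏ (λ k → x (suc k) - x zero) *_) (∏-newton-diag (x ∘ suc)))) ⟩
    1ℤ * (∏ (λ k → x (suc k) - x zero) * differences (x ∘ suc))
      ≡⟨ *-assoc 1ℤ (∏ (λ k → x (suc k) - x zero)) _ ⟨
    1ℤ * ∏ (λ k → x (suc k) - x zero) * differences (x ∘ suc)
      ≡⟨ cong (1ℤ * ∏ (λ k → x (suc k) - x zero) *_)
          (∏-cong {s} λ i → trans (∏-cong {s} λ j → cong (λ b → if b then (x (suc j) - x (suc i)) else 1ℤ)
          (suc-<? i j)) (sym (*-identityˡ _))) ⟩
    differences x ∎
    where
    suc-<? : ∀ {s} (i j : Fin s) → ⌊ i F.<? j ⌋ ≡ ⌊ suc i F.<? suc j ⌋
    suc-<? i j = trans (isYes≗does (i F.<? j)) (sym (isYes≗does (suc i F.<? suc j)))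

  triangular : ℕ → ℕ
  triangular zero    = 0
  triangular (suc s) = triangular s ℕ.+ s

  triangular-/2 : ∀ s → (s ℕ.* (s ℕ.∸ 1)) / 2 ≡ triangular s
  triangular-/2 s = trans (cong (_/ 2) (double s)) (m*n/n≡m (triangular s) 2)
    where
    step : ∀ s → suc (suc s) ℕ.* suc s ≡ suc s ℕ.* s ℕ.+ suc s ℕ.* 2
    step = ℕ-Solver.solve-∀
    double : ∀ s → s ℕ.* (s ℕ.∸ 1) ≡ triangular s ℕ.* 2
    double zero          = refl
    double (suc zero)    = refl
    double (suc (suc s)) = trans (step s) (trans (cong (ℕ._+ suc s ℕ.* 2) (double (suc s)))
        (sym (ℕₚ.*-distribʳ-+ 2 (triangular (suc s)) (suc s))))

  pos-^ : ∀ q k → + (q ℕ.^ k) ≡ (+ q) ^ k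
  pos-^ q zero    = refl
  pos-^ q (suc k) = trans (pos-* q (q ℕ.^ k)) (cong (+ q *_) (pos-^ q k))

  ∏-powers : ∀ c s → ∏ {s} (λ k → c ^ toℕ k) ≡ c ^ triangular s
  ∏-powers c zero    = refl
  ∏-powers c (suc s) = begin
    ∏ {suc s} (λ k → c ^ toℕ k)
      ≡⟨ ∏-init-last {s} (λ k → c ^ toℕ k) ⟩
    ∏ {s} (λ k → c ^ toℕ (inject₁ k)) * c ^ toℕ (fromℕ s)
      ≡⟨ cong₂ _*_ (trans (∏-cong {s} λ k → cong (c ^_) (Finₚ.toℕ-inject₁ k)) (∏-powers c s))
          (cong (c ^_) (Finₚ.toℕ-fromℕ s)) ⟩
    c ^ triangular s * c ^ s
      ≡⟨ ^-distribˡ-+-* c (triangular s) s ⟨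
    c ^ triangular (suc s) ∎

  ∏-factorials : ∀ s → ∏ {s} (λ k → + (toℕ k !)) ≡ + superfact s
  ∏-factorials zero          = refl
  ∏-factorials (suc zero)    = refl
  ∏-factorials (suc (suc s)) = begin
    ∏ {suc (suc s)} (λ k → + (toℕ k !))
      ≡⟨ ∏-init-last {suc s} (λ k → + (toℕ k !)) ⟩
    ∏ {suc s} (λ k → + (toℕ (inject₁ k) !)) * + (toℕ (fromℕ (suc s)) !)
      ≡⟨ cong₂ _*_ (trans (∏-cong {suc s} λ k → cong (λ t → + (t !)) (Finₚ.toℕ-inject₁ k))
          (∏-factorials (suc s))) (cong (λ t → + (t !)) (Finₚ.toℕ-fromℕ (suc s))) ⟩
    + superfact (suc s) * + (suc s !)
      ≡⟨ *-comm (+ superfact (suc s)) (+ (suc s !)) ⟩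
    + (suc s !) * + superfact (suc s)
      ≡⟨ pos-* (suc s !) (superfact (suc s)) ⟨
    + superfact (suc (suc s)) ∎

  binomMatrix : ∀ q {s} → (Fin s → ℕ) → Matrix s s
  binomMatrix q g k l = scaledBinom q (g l) (toℕ k)

  -- `T` expresses the Newton polynomials, scaled by q^k, in the scaled binomials, so
  -- `T ⊗ binomMatrix q g` is the scaled Newton matrix. `T` is lower triangular with diagonal
  -- entries k!, the Newton matrix is upper triangular, and both determinants are read off the
  -- diagonals.
  det-binomMatrix : ∀ q {s} (g : Fin s → ℕ) →
    + superfact s * det (binomMatrix q g) ≡ (+ q) ^ triangular s * differences (λ i → + g i)
  det-binomMatrix q {s} g = begin
    + superfact s * det (binomMatrix q g)
      ≡⟨ cong (_* det (binomMatrix q g)) (trans (∏-cong λ k → binomCoeff-diag q (λ m → + g (inject {i = k} m)))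
          (∏-factorials s)) ⟨
    ∏ (λ k → T k k) * det (binomMatrix q g)
      ≡⟨ cong (_* det (binomMatrix q g)) (det-lower T λ {k} i<j → binomCoeff-upper q
          (λ m → + g (inject {i = k} m)) i<j) ⟨
    det T * det (binomMatrix q g)
      ≡⟨ det-⊗ T (binomMatrix q g) ⟨
    det (T ⊗ binomMatrix q g)
      ≡⟨ det-cong (λ k l → binomCoeff-expand q (λ m → + g (inject {i = k} m)) s (g l) (Finₚ.toℕ<n k)) ⟨
    det (λ k l → (+ q) ^ toℕ k * newton (λ i → + g i) k l)
      ≡⟨ det-scale (λ k → (+ q) ^ toℕ k) (newton (λ i → + g i)) ⟩
    ∏ (λ (k : Fin s) → (+ q) ^ toℕ k) * det (newton (λ i → + g i))
      ≡⟨ cong₂ _*_ (∏-powers (+ q) s) (trans (det-upper (newton (λ i → + g i)) (newton-lower λ i → + g i))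
          (∏-newton-diag λ i → + g i)) ⟩
    (+ q) ^ triangular s * differences (λ i → + g i) ∎
    where
    T : Matrix s s
    T k i = binomCoeff q (λ m → + g (inject {i = k} m)) (toℕ i)

-- Sums over words and over codes of given strength.

module DesignSums where

  open import Defs
  open import Data.Nat using (zero; suc)
  open import Data.Integer using (ℤ; +_; _+_; _*_; _^_; 0ℤ; 1ℤ)
  open import Data.Integer.Properties
  open import Data.Integer.Tactic.RingSolver using (solve-∀)
  open import Data.Fin as F using (Fin; zero; suc; punchIn)
  import Data.Fin.Properties as Finₚ
  open import Data.Bool using (Bool; true; false; _∧_; if_then_else_)
  open import Data.List using (List; []; _∷_; length)
  open import Data.List.Membership.Propositional using (_∈_)
  open import Data.List.Relation.Unary.Any using (here; there)
  open import Data.Vec using ([]; _∷_; lookup)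
  open import Data.Vec.Functional using (Vector)
  open import Data.Product using (_,_)
  open import Relation.Binary.PropositionalEquality
  open import Relation.Nullary using (yes; no; contradiction)
  open import Relation.Nullary.Decidable using (⌊_⌋)
  open import Function using (_∘_)
  open import Function.Definitions using (Injective)
  open Sums
  open Determinant using (∏; ∏-cong; ∏-const; ∏-one)
  open SymmetricFunctions using (esym)

  open ≡-Reasoning

  ∑∈ : ∀ {A : Set} → List A → (A → ℤ) → ℤ
  ∑∈ []       f = 0ℤ
  ∑∈ (x ∷ xs) f = f x + ∑∈ xs f

  ∑∈-cong : ∀ {A : Set} (xs : List A) {f g : A → ℤ} → (∀ {x} → x ∈ xs → f x ≡ g x) → ∑∈ xs f ≡ ∑∈ xs g
  ∑∈-cong []       f≗g = refl
  ∑∈-cong (x ∷ xs) f≗g = cong₂ _+_ (f≗g (here refl)) (∑∈-cong xs (f≗g ∘ there))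

  ∑∈-+ : ∀ {A : Set} (xs : List A) (f g : A → ℤ) → ∑∈ xs (λ x → f x + g x) ≡ ∑∈ xs f + ∑∈ xs g
  ∑∈-+ []       f g = refl
  ∑∈-+ (x ∷ xs) f g = trans (cong (λ t → f x + g x + t) (∑∈-+ xs f g))
      (interchange (f x) (g x) (∑∈ xs f) (∑∈ xs g))
    where
    interchange : ∀ a b c d → a + b + (c + d) ≡ a + c + (b + d)
    interchange = solve-∀

  ∑∈-*ˡ : ∀ {A : Set} (xs : List A) c (f : A → ℤ) → c * ∑∈ xs f ≡ ∑∈ xs λ x → c * f x
  ∑∈-*ˡ []       c f = *-zeroʳ c
  ∑∈-*ˡ (x ∷ xs) c f = trans (*-distribˡ-+ c (f x) (∑∈ xs f)) (cong (λ t → c * f x + t) (∑∈-*ˡ xs c f))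

  ∑∈-zero : ∀ {A : Set} (xs : List A) → ∑∈ xs (λ _ → 0ℤ) ≡ 0ℤ
  ∑∈-zero []       = refl
  ∑∈-zero (x ∷ xs) = trans (+-identityˡ _) (∑∈-zero xs)

  ∑∈-one : ∀ {A : Set} (xs : List A) → ∑∈ xs (λ _ → 1ℤ) ≡ + length xs
  ∑∈-one []       = refl
  ∑∈-one (x ∷ xs) = cong (λ t → 1ℤ + t) (∑∈-one xs)

  ∑∈-∑ : ∀ {A : Set} {n} (xs : List A) (f : A → Vector ℤ n) → ∑∈ xs (λ x → ∑ (f x)) ≡ ∑ λ i → ∑∈ xs λ x → f x i
  ∑∈-∑ []       f = sym (∑-zero λ i → refl)
  ∑∈-∑ (x ∷ xs) f = trans (cong (λ t → ∑ (f x) + t) (∑∈-∑ xs f)) (sym (∑-+ (f x) λ i → ∑∈ xs λ x → f x i))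

  ∑-one : ∀ n → ∑ {n} (λ _ → 1ℤ) ≡ + n
  ∑-one zero    = ∑-empty _
  ∑-one (suc n) = trans (∑-suc _) (cong (λ t → 1ℤ + t) (∑-one n))

  indicator : Bool → ℤ
  indicator b = if b then 1ℤ else 0ℤ

  indicator-∧ : ∀ a b → indicator (a ∧ b) ≡ indicator a * indicator b
  indicator-∧ true  b = sym (*-identityˡ (indicator b))
  indicator-∧ false b = refl

  δ : ∀ {q} → Fin q → Fin q → ℤ
  δ a b = indicator ⌊ a F.≟ b ⌋

  δ-refl : ∀ {q} (a : Fin q) → δ a a ≡ 1ℤ
  δ-refl a with a F.≟ a
  ... | yes _   = refl
  ... | no  a≢a = contradiction refl a≢a

  δ-≢ : ∀ {q} {a b : Fin q} → a ≢ b → δ a b ≡ 0ℤ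
  δ-≢ {a = a} {b} a≢b with a F.≟ b
  ... | yes a≡b = contradiction a≡b a≢b
  ... | no  _   = refl

  δ-sym : ∀ {q} (a b : Fin q) → δ a b ≡ δ b a
  δ-sym a b with a F.≟ b
  ... | yes refl = sym (δ-refl a)
  ... | no  a≢b  = sym (δ-≢ (a≢b ∘ sym))

  ∑-δ : ∀ {q} (a : Fin q) (f : Fin q → ℤ) → ∑ (λ b → δ a b * f b) ≡ f a
  ∑-δ {suc q} a f = begin
    ∑ (λ b → δ a b * f b)
      ≡⟨ ∑-remove a (λ b → δ a b * f b) ⟩
    δ a a * f a + ∑ (λ i → δ a (punchIn a i) * f (punchIn a i))
      ≡⟨ cong₂ (λ s t → s * f a + t) (δ-refl a) (∑-zero {f = λ i → δ a (punchIn a i) * f (punchIn a i)}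
          λ i → cong (_* f (punchIn a i)) (δ-≢ (Finₚ.punchInᵢ≢i a i ∘ sym))) ⟩
    1ℤ * f a + 0ℤ
      ≡⟨ trans (+-identityʳ _) (*-identityˡ (f a)) ⟩
    f a ∎

  ∑W : ∀ {q} n → (Word q n → ℤ) → ℤ
  ∑W zero    f = f []
  ∑W (suc n) f = ∑ λ a → ∑W n λ y → f (a ∷ y)

  ∑W-cong : ∀ {q} n {f g : Word q n → ℤ} → f ≗ g → ∑W n f ≡ ∑W n g
  ∑W-cong zero    f≗g = f≗g []
  ∑W-cong (suc n) f≗g = ∑-cong λ a → ∑W-cong n λ y → f≗g (a ∷ y)

  ∑W-zero : ∀ {q} n → ∑W {q} n (λ _ → 0ℤ) ≡ 0ℤ
  ∑W-zero zero    = refl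
  ∑W-zero (suc n) = ∑-zero λ a → ∑W-zero n

  ∑W-+ : ∀ {q} n (f g : Word q n → ℤ) → ∑W n (λ y → f y + g y) ≡ ∑W n f + ∑W n g
  ∑W-+ zero    f g = refl
  ∑W-+ (suc n) f g = trans (∑-cong λ a → ∑W-+ n (f ∘ (a ∷_)) (g ∘ (a ∷_)))
      (∑-+ (λ a → ∑W n (f ∘ (a ∷_))) (λ a → ∑W n (g ∘ (a ∷_))))

  ∑W-*ˡ : ∀ {q} n c (f : Word q n → ℤ) → c * ∑W n f ≡ ∑W n λ y → c * f y
  ∑W-*ˡ zero    c f = refl
  ∑W-*ˡ (suc n) c f = trans (∑-*ˡ c _) (∑-cong λ a → ∑W-*ˡ n c (f ∘ (a ∷_)))

  ∑∈-∑W : ∀ {A : Set} {q} n (xs : List A) (f : A → Word q n → ℤ) → ∑∈ xs (λ x → ∑W n (f x)) ≡ ∑W n λ w → ∑∈ xs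
      λ x → f x w
  ∑∈-∑W zero    xs f = refl
  ∑∈-∑W (suc n) xs f = trans (∑∈-∑ xs _) (∑-cong λ a → ∑∈-∑W n xs λ x w → f x (a ∷ w))

  ∑W-∏ : ∀ {q} t (f : Fin t → Fin q → ℤ) → ∑W t (λ w → ∏ λ k → f k (lookup w k)) ≡ ∏ λ k → ∑ (f k)
  ∑W-∏ zero    f = refl
  ∑W-∏ (suc t) f = begin
    ∑ (λ a → ∑W t λ w → f zero a * ∏ λ k → f (suc k) (lookup w k))
      ≡⟨ ∑-cong (λ a → trans (sym (∑W-*ˡ t (f zero a) _)) (cong (f zero a *_) (∑W-∏ t (f ∘ suc)))) ⟩
    ∑ (λ a → f zero a * ∏ λ k → ∑ (f (suc k)))
      ≡⟨ ∑-*ʳ (∏ λ k → ∑ (f (suc k))) (f zero) ⟨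
    ∑ (f zero) * ∏ (λ k → ∑ (f (suc k))) ∎

  -- Among all patterns `w` only the restriction of `y` to `cols` contributes. This turns a product
  -- of functions of single coordinates into a combination of the indicators that `countRows`
  -- counts.
  ∑W-agrees : ∀ {q n} t (cols : Fin t → Fin n) (f : Fin t → Fin q → ℤ) (y : Word q n) →
    ∑W t (λ w → ∏ (λ k → f k (lookup w k)) * indicator (agreesOn cols (lookup w) y)) ≡ ∏ λ k → f k
        (lookup y (cols k))
  ∑W-agrees zero    cols f y = refl
  ∑W-agrees (suc t) cols f y = begin
    ∑ (λ a → ∑W t λ w → f zero a * ∏ (λ k → f (suc k) (lookup w k)) * indicator
        (⌊ b F.≟ a ⌋ ∧ agreesOn (cols ∘ suc) (lookup w) y))
      ≡⟨ ∑-cong (λ a → trans (∑W-cong t λ w → trans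
          (cong (f zero a * ∏ (λ k → f (suc k) (lookup w k)) *_) (indicator-∧ ⌊ b F.≟ a ⌋ _))
          (regroup (f zero a) (∏ (λ k → f (suc k) (lookup w k))) (δ b a) _))
          (sym (∑W-*ˡ t (δ b a * f zero a) _))) ⟩
    ∑ (λ a → δ b a * f zero a * ∑W t λ w → ∏ (λ k → f (suc k) (lookup w k)) * indicator
        (agreesOn (cols ∘ suc) (lookup w) y))
      ≡⟨ ∑-*ʳ _ (λ a → δ b a * f zero a) ⟨
    ∑ (λ a → δ b a * f zero a) * ∑W t (λ w → ∏ (λ k → f (suc k) (lookup w k)) * indicator
        (agreesOn (cols ∘ suc) (lookup w) y))
      ≡⟨ cong₂ _*_ (∑-δ b (f zero)) (∑W-agrees t (cols ∘ suc) (f ∘ suc) y) ⟩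
    f zero b * ∏ (λ k → f (suc k) (lookup y (cols (suc k)))) ∎
    where
    b = lookup y (cols zero)
    regroup : ∀ f p d i → f * p * (d * i) ≡ d * f * (p * i)
    regroup = solve-∀

  countRows-∑∈ : ∀ {q n t} (cols : Fin t → Fin n) (a : Fin t → Fin q) ys →
    ∑∈ ys (λ y → indicator (agreesOn cols a y)) ≡ + countRows cols a ys
  countRows-∑∈ cols a []       = refl
  countRows-∑∈ cols a (y ∷ ys) = begin
    indicator (agreesOn cols a y) + ∑∈ ys (λ y → indicator (agreesOn cols a y))
      ≡⟨ cong₂ _+_ (pos (agreesOn cols a y)) (countRows-∑∈ cols a ys) ⟩
    + (if agreesOn cols a y then 1 else 0) + + countRows cols a ys
      ≡⟨ pos-+ (if agreesOn cols a y then 1 else 0) (countRows cols a ys) ⟨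
    + countRows cols a (y ∷ ys) ∎
    where
    pos : ∀ b → indicator b ≡ + (if b then 1 else 0)
    pos true  = refl
    pos false = refl

  -- Every pattern on the chosen columns occurs equally often, so the sum over the code is that
  -- common count times a sum over all patterns, which factors. The power of `suc q` replaces a
  -- division of the code size by it.
  design-∏ : ∀ {q n t} (C : Code (suc q) n) → IsDesign t C →
    (cols : Fin t → Fin n) → Injective _≡_ _≡_ cols → (f : Fin t → Fin (suc q) → ℤ) →
    (+ suc q) ^ t * ∑∈ (elems C) (λ y → ∏ λ k → f k (lookup y (cols k))) ≡ + size C * ∏ λ k → ∑ (f k)
  design-∏ {q} {n} {t} C (_ , design) cols cols-inj f = begin
    (+ suc q) ^ t * ∑∈ (elems C) (λ y → ∏ λ k → f k (lookup y (cols k)))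
      ≡⟨ cong ((+ suc q) ^ t *_) (average f) ⟩
    (+ suc q) ^ t * (μ * ∏ λ k → ∑ (f k))
      ≡⟨ regroup ((+ suc q) ^ t) μ (∏ λ k → ∑ (f k)) ⟩
    μ * (+ suc q) ^ t * ∏ (λ k → ∑ (f k))
      ≡⟨ cong (_* ∏ λ k → ∑ (f k)) size-C ⟨
    + size C * ∏ (λ k → ∑ (f k)) ∎
    where
    -- The all-zero pattern is only a reference; the design condition equates all counts with this
    -- one.
    μ = + countRows cols (λ _ → zero) (elems C)
    regroup : ∀ a b c → a * (b * c) ≡ b * a * c
    regroup = solve-∀
    average : ∀ f → ∑∈ (elems C) (λ y → ∏ λ k → f k (lookup y (cols k))) ≡ μ * ∏ λ k → ∑ (f k)
    average f = begin
      ∑∈ (elems C) (λ y → ∏ λ k → f k (lookup y (cols k)))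
        ≡⟨ ∑∈-cong (elems C) (λ {y} _ → sym (∑W-agrees t cols f y)) ⟩
      ∑∈ (elems C) (λ y → ∑W t λ w → ∏ (λ k → f k (lookup w k)) * indicator (agreesOn cols (lookup w) y))
        ≡⟨ ∑∈-∑W t (elems C) _ ⟩
      ∑W t (λ w → ∑∈ (elems C) λ y → ∏ (λ k → f k (lookup w k)) * indicator (agreesOn cols (lookup w) y))
        ≡⟨ ∑W-cong t (λ w → trans (sym (∑∈-*ˡ (elems C) (∏ λ k → f k (lookup w k)) _))
            (trans (cong (∏ (λ k → f k (lookup w k)) *_)
            (trans (countRows-∑∈ cols (lookup w) (elems C))
            (cong +_ (design cols cols-inj (lookup w) λ _ → zero)))) (*-comm (∏ λ k → f k (lookup w k)) μ))) ⟩
      ∑W t (λ w → μ * ∏ λ k → f k (lookup w k))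
        ≡⟨ ∑W-*ˡ t μ _ ⟨
      μ * ∑W t (λ w → ∏ λ k → f k (lookup w k))
        ≡⟨ cong (μ *_) (∑W-∏ t f) ⟩
      μ * ∏ (λ k → ∑ (f k)) ∎
    size-C : + size C ≡ μ * (+ suc q) ^ t
    size-C = begin
      + size C
        ≡⟨ ∑∈-one (elems C) ⟨
      ∑∈ (elems C) (λ _ → 1ℤ)
        ≡⟨ ∑∈-cong (elems C) (λ _ → sym (∏-one {t} λ _ → refl)) ⟩
      ∑∈ (elems C) (λ _ → ∏ {t} λ _ → 1ℤ)
        ≡⟨ average (λ _ _ → 1ℤ) ⟩
      μ * ∏ {t} (λ _ → ∑ {suc q} λ _ → 1ℤ)
        ≡⟨ cong (μ *_) (trans (∏-cong {t} λ _ → ∑-one (suc q)) (∏-const t (+ suc q))) ⟩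
      μ * (+ suc q) ^ t ∎

-- Functions of bounded degree and their averages over a design.

module Monomials where

  open import Defs
  open import Data.Nat as ℕ using (ℕ; zero; suc; s≤s; z≤n)
  import Data.Nat.Properties as ℕₚ
  open import Data.Integer using (ℤ; +_; _+_; _*_; _^_; 0ℤ; 1ℤ; NonZero)
  open import Data.Integer.Properties
  open import Data.Integer.Tactic.RingSolver using (solve-∀)
  open import Data.Fin using (Fin; zero; suc)
  import Data.Fin.Properties as Finₚ
  open import Data.Vec as Vec using (Vec; []; _∷_; lookup; head; tail; zipWith)
  open import Data.Maybe using (Maybe; just; nothing)
  open import Data.Product using (_×_; _,_; ∃; proj₁)
  open import Relation.Binary.PropositionalEquality
  open import Relation.Nullary using (yes; no; contradiction)
  open import Function.Definitions using (Injective)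
  open Sums
  open Determinant using (∏; ∏-cong; ∏-const; ∏-one)
  open SymmetricFunctions using (esym)
  open DesignSums

  open ≡-Reasoning

  -- nothing is a coordinate that a monomial does not involve.
  Factor : ℕ → Set
  Factor q = Maybe (Fin q → ℤ)

  Monomial : ℕ → ℕ → Set
  Monomial q n = Vec (Factor q) n

  evalFactor : ∀ {q} → Factor q → Fin q → ℤ
  evalFactor nothing  a = 1ℤ
  evalFactor (just f) a = f a

  factorWeight : ∀ {q} → Factor q → ℕ
  factorWeight nothing  = 0
  factorWeight (just f) = 1

  ⟦_⟧ : ∀ {q n} → Monomial q n → Word q n → ℤ
  ⟦ [] ⟧    y = 1ℤ
  ⟦ f ∷ m ⟧ y = evalFactor f (head y) * ⟦ m ⟧ (tail y)

  weight : ∀ {q n} → Monomial q n → ℕ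
  weight []            = 0
  weight (nothing ∷ m) = weight m
  weight (just f ∷ m)  = suc (weight m)

  total : ∀ {q n} → Monomial q n → ℤ
  total []      = 1ℤ
  total (f ∷ m) = ∑ (evalFactor f) * total m

  ∑W-monomial : ∀ {q n} (m : Monomial q n) → ∑W n ⟦ m ⟧ ≡ total m
  ∑W-monomial []      = refl
  ∑W-monomial (f ∷ m) = trans
    (∑-cong λ a → trans (sym (∑W-*ˡ _ (evalFactor f a) ⟦ m ⟧)) (cong (evalFactor f a *_) (∑W-monomial m)))
    (sym (∑-*ʳ (total m) (evalFactor f)))

  columns : ∀ {q n} (m : Monomial q n) → Fin (weight m) → Fin n
  columns (nothing ∷ m) k       = suc (columns m k)
  columns (just f ∷ m)  zero    = zero
  columns (just f ∷ m)  (suc k) = suc (columns m k)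

  factors : ∀ {q n} (m : Monomial q n) → Fin (weight m) → Fin q → ℤ
  factors (nothing ∷ m) k       = factors m k
  factors (just f ∷ m)  zero    = f
  factors (just f ∷ m)  (suc k) = factors m k

  columns-injective : ∀ {q n} (m : Monomial q n) → Injective _≡_ _≡_ (columns m)
  columns-injective (nothing ∷ m) eq = columns-injective m (Finₚ.suc-injective eq)
  columns-injective (just f ∷ m) {zero}  {zero}  eq = refl
  columns-injective (just f ∷ m) {suc k} {suc l} eq = cong suc (columns-injective m (Finₚ.suc-injective eq))

  eval-∏ : ∀ {q n} (m : Monomial q n) y → ⟦ m ⟧ y ≡ ∏ λ k → factors m k (lookup y (columns m k))
  eval-∏ []            y       = refl
  eval-∏ (nothing ∷ m) (a ∷ y) = trans (*-identityˡ _) (eval-∏ m y)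
  eval-∏ (just f ∷ m)  (a ∷ y) = cong (f a *_) (eval-∏ m y)

  total-∏ : ∀ {q n} (m : Monomial q n) → (+ q) ^ weight m * total m ≡ (+ q) ^ n * ∏ λ k → ∑ (factors m k)
  total-∏ [] = refl
  total-∏ {q} {suc n} (nothing ∷ m) = begin
    (+ q) ^ weight m * (∑ {q} (λ _ → 1ℤ) * total m)
      ≡⟨ cong (λ t → (+ q) ^ weight m * (t * total m)) (∑-one q) ⟩
    (+ q) ^ weight m * (+ q * total m)
      ≡⟨ rotate ((+ q) ^ weight m) (+ q) (total m) ⟩
    + q * ((+ q) ^ weight m * total m)
      ≡⟨ cong (+ q *_) (total-∏ m) ⟩
    + q * ((+ q) ^ n * ∏ λ k → ∑ (factors m k))
      ≡⟨ *-assoc (+ q) ((+ q) ^ n) _ ⟨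
    (+ q) ^ suc n * ∏ (λ k → ∑ (factors m k)) ∎
    where
    rotate : ∀ a b c → a * (b * c) ≡ b * (a * c)
    rotate = solve-∀
  total-∏ {q} {suc n} (just f ∷ m) = begin
    + q * (+ q) ^ weight m * (∑ f * total m)
      ≡⟨ regroup (+ q) ((+ q) ^ weight m) (∑ f) (total m) ⟩
    + q * ∑ f * ((+ q) ^ weight m * total m)
      ≡⟨ cong (+ q * ∑ f *_) (total-∏ m) ⟩
    + q * ∑ f * ((+ q) ^ n * ∏ λ k → ∑ (factors m k))
      ≡⟨ regroup (+ q) (∑ f) ((+ q) ^ n) _ ⟩
    + q * (+ q) ^ n * (∑ f * ∏ λ k → ∑ (factors m k)) ∎
    where
    regroup : ∀ a b c d → a * b * (c * d) ≡ a * c * (b * d)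
    regroup = solve-∀

  -- Strength speaks of exactly `t` columns, so a lighter monomial receives constant factors 1 until
  -- it involves `t` of them. A free coordinate stays free as long as the tail still has room for
  -- all `t`.
  pad : ∀ {q n} (m : Monomial q n) t → weight m ℕ.≤ t → t ℕ.≤ n →
    ∃ λ (m′ : Monomial q n) → weight m′ ≡ t × ⟦ m′ ⟧ ≗ ⟦ m ⟧ × total m′ ≡ total m
  pad []           zero    w≤t       t≤n       = [] , refl , (λ _ → refl) , refl
  pad (just f ∷ m) (suc t) (s≤s w≤t) (s≤s t≤n) with pad m t w≤t t≤n
  ... | m′ , w≡t , m′≗m , total≡ = just f ∷ m′ , cong suc w≡t ,
      (λ y → cong (f (head y) *_) (m′≗m (tail y))) , cong (∑ f *_) total≡
  pad {n = suc n} (nothing ∷ m) t w≤t t≤n with t ℕ.≤? n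
  ... | yes t≤n′ with pad m t w≤t t≤n′
  ...   | m′ , w≡t , m′≗m , total≡ = nothing ∷ m′ , w≡t , (λ y → cong (1ℤ *_) (m′≗m (tail y))) , cong
      (∑ _ *_) total≡
  pad {n = suc n} (nothing ∷ m) zero w≤t t≤n | no t≰n = contradiction z≤n t≰n
  pad {n = suc n} (nothing ∷ m) (suc t) w≤t (s≤s t≤n) | no t≰n
    with pad m t (ℕₚ.≤-trans (weight≤ m) (ℕₚ.≤-pred (ℕₚ.≰⇒> t≰n))) t≤n
    where
    weight≤ : ∀ {q n} (m : Monomial q n) → weight m ℕ.≤ n
    weight≤ []            = z≤n
    weight≤ (nothing ∷ m) = ℕₚ.m≤n⇒m≤1+n (weight≤ m)
    weight≤ (just f ∷ m)  = s≤s (weight≤ m)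
  ... | m′ , w≡t , m′≗m , total≡ = just (λ _ → 1ℤ) ∷ m′ , cong suc w≡t ,
      (λ y → cong (1ℤ *_) (m′≗m (tail y))) , cong (∑ _ *_) total≡

  -- The mean over the code equals the mean over all words, with both denominators multiplied out.
  IsAveraged : ∀ {q n} → Code q n → (Word q n → ℤ) → Set
  IsAveraged {q} {n} C f = (+ q) ^ n * ∑∈ (elems C) f ≡ + size C * ∑W n f

  ^-nonZero : ∀ q k → NonZero ((+ suc q) ^ k)
  ^-nonZero q zero    = _
  ^-nonZero q (suc k) = i*j≢0 (+ suc q) ((+ suc q) ^ k) {{_}} {{^-nonZero q k}}

  design-monomial : ∀ {q n t} (C : Code (suc q) n) → IsDesign t C →
    (m : Monomial (suc q) n) → weight m ℕ.≤ t → IsAveraged C ⟦ m ⟧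
  design-monomial {q} {n} {t} C design m w≤t with pad m t w≤t (proj₁ design)
  ... | m′ , refl , m′≗m , total≡ = *-cancelˡ-≡ (Q ^ t) _ _ {{^-nonZero q t}} (begin
    Q ^ t * (Q ^ n * ∑∈ (elems C) ⟦ m ⟧)
      ≡⟨ cong (λ u → Q ^ t * (Q ^ n * u)) (∑∈-cong (elems C) λ {y} _ → trans (sym (m′≗m y)) (eval-∏ m′ y)) ⟩
    Q ^ t * (Q ^ n * ∑∈ (elems C) λ y → ∏ λ k → factors m′ k (lookup y (columns m′ k)))
      ≡⟨ rotate (Q ^ t) (Q ^ n) _ ⟩
    Q ^ n * (Q ^ t * ∑∈ (elems C) λ y → ∏ λ k → factors m′ k (lookup y (columns m′ k)))
      ≡⟨ cong (Q ^ n *_) (design-∏ C design (columns m′) (columns-injective m′) (factors m′)) ⟩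
    Q ^ n * (+ size C * ∏ λ k → ∑ (factors m′ k))
      ≡⟨ rotate (Q ^ n) (+ size C) _ ⟩
    + size C * (Q ^ n * ∏ λ k → ∑ (factors m′ k))
      ≡⟨ cong (+ size C *_) (total-∏ m′) ⟨
    + size C * (Q ^ t * total m′)
      ≡⟨ cong (λ u → + size C * (Q ^ t * u)) (trans total≡ (sym (∑W-monomial m))) ⟩
    + size C * (Q ^ t * ∑W n ⟦ m ⟧)
      ≡⟨ rotate (+ size C) (Q ^ t) _ ⟩
    Q ^ t * (+ size C * ∑W n ⟦ m ⟧) ∎)
    where
    Q = + suc q
    rotate : ∀ a b c → a * (b * c) ≡ b * (a * c)
    rotate = solve-∀

  -- The degree counts the coordinates that a term involves, whatever the functions on them.
  -- `respects` takes the place of function extensionality.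
  data Degree≤ {q n} (r : ℕ) : (Word q n → ℤ) → Set where
    monomial : ∀ m → weight m ℕ.≤ r → Degree≤ r ⟦ m ⟧
    zero     : Degree≤ r λ _ → 0ℤ
    plus     : ∀ {f g} → Degree≤ r f → Degree≤ r g → Degree≤ r λ y → f y + g y
    respects : ∀ {f g} → f ≗ g → Degree≤ r f → Degree≤ r g

  design-average : ∀ {q n t} (C : Code (suc q) n) → IsDesign t C → ∀ {f} → Degree≤ t f → IsAveraged C f
  design-average C design (monomial m w≤t) = design-monomial C design m w≤t
  design-average {q} {n} C design zero = begin
    (+ suc q) ^ n * ∑∈ (elems C) (λ _ → 0ℤ) ≡⟨ cong ((+ suc q) ^ n *_) (∑∈-zero (elems C)) ⟩
    (+ suc q) ^ n * 0ℤ                      ≡⟨ *-zeroʳ ((+ suc q) ^ n) ⟩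
    0ℤ                                      ≡⟨ *-zeroʳ (+ size C) ⟨
    + size C * 0ℤ                           ≡⟨ cong (+ size C *_) (∑W-zero n) ⟨
    + size C * ∑W n (λ _ → 0ℤ)              ∎
  design-average {q} {n} C design (plus {f} {g} df dg) = begin
    (+ suc q) ^ n * ∑∈ (elems C) (λ y → f y + g y)
      ≡⟨ trans (cong ((+ suc q) ^ n *_) (∑∈-+ (elems C) f g)) (*-distribˡ-+ ((+ suc q) ^ n) _ _) ⟩
    (+ suc q) ^ n * ∑∈ (elems C) f + (+ suc q) ^ n * ∑∈ (elems C) g
      ≡⟨ cong₂ _+_ (design-average C design df) (design-average C design dg) ⟩
    + size C * ∑W n f + + size C * ∑W n g
      ≡⟨ trans (cong (+ size C *_) (∑W-+ n f g)) (*-distribˡ-+ (+ size C) _ _) ⟨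
    + size C * ∑W n (λ y → f y + g y) ∎
  design-average {q} {n} C design (respects {f} {g} f≗g df) = begin
    (+ suc q) ^ n * ∑∈ (elems C) g ≡⟨ cong ((+ suc q) ^ n *_) (∑∈-cong (elems C) λ {y} _ → f≗g y) ⟨
    (+ suc q) ^ n * ∑∈ (elems C) f ≡⟨ design-average C design df ⟩
    + size C * ∑W n f              ≡⟨ cong (+ size C *_) (∑W-cong n f≗g) ⟩
    + size C * ∑W n g              ∎

  Degree≤-weaken : ∀ {q n r r′} {f : Word q n → ℤ} → r ℕ.≤ r′ → Degree≤ r f → Degree≤ r′ f
  Degree≤-weaken r≤r′ (monomial m w≤r)  = monomial m (ℕₚ.≤-trans w≤r r≤r′)
  Degree≤-weaken r≤r′ zero              = zero
  Degree≤-weaken r≤r′ (plus df dg)      = plus (Degree≤-weaken r≤r′ df) (Degree≤-weaken r≤r′ dg)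
  Degree≤-weaken r≤r′ (respects f≗g df) = respects f≗g (Degree≤-weaken r≤r′ df)

  Degree≤-one : ∀ {q n r} → Degree≤ {q} {n} r λ _ → 1ℤ
  Degree≤-one {n = n} = respects (eval n) (monomial (Vec.replicate n nothing)
      (ℕₚ.≤-trans (ℕₚ.≤-reflexive (weight≡0 n)) z≤n))
    where
    eval : ∀ {q} n (y : Word q n) → ⟦ Vec.replicate n nothing ⟧ y ≡ 1ℤ
    eval zero    []      = refl
    eval (suc n) (a ∷ y) = trans (*-identityˡ _) (eval n y)
    weight≡0 : ∀ {q} n → weight {q} (Vec.replicate n nothing) ≡ 0
    weight≡0 zero    = refl
    weight≡0 (suc n) = weight≡0 n

  Degree≤-∷ : ∀ {q n r} (h : Factor q) {f : Word q n → ℤ} → Degree≤ r f →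
    Degree≤ (factorWeight h ℕ.+ r) λ y → evalFactor h (head y) * f (tail y)
  Degree≤-∷ nothing  (monomial m w≤r)  = monomial (nothing ∷ m) w≤r
  Degree≤-∷ (just h) (monomial m w≤r)  = monomial (just h ∷ m) (s≤s w≤r)
  Degree≤-∷ h zero                     = respects (λ y → sym (*-zeroʳ (evalFactor h (head y)))) zero
  Degree≤-∷ h (plus {f} {g} df dg)     = respects (λ y → sym
      (*-distribˡ-+ (evalFactor h (head y)) (f (tail y)) (g (tail y)))) (plus (Degree≤-∷ h df) (Degree≤-∷ h dg))
  Degree≤-∷ h (respects f≗g df)        = respects (λ y → cong (evalFactor h (head y) *_) (f≗g (tail y)))
      (Degree≤-∷ h df)

  _·_ : ∀ {q} → Factor q → Factor q → Factor q
  nothing · g       = g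
  just f  · nothing = just f
  just f  · just g  = just λ a → f a * g a

  ·-eval : ∀ {q} (f g : Factor q) a → evalFactor (f · g) a ≡ evalFactor f a * evalFactor g a
  ·-eval nothing  g        a = sym (*-identityˡ (evalFactor g a))
  ·-eval (just f) nothing  a = sym (*-identityʳ (f a))
  ·-eval (just f) (just g) a = refl

  zipWith-eval : ∀ {q n} (m m′ : Monomial q n) y → ⟦ zipWith _·_ m m′ ⟧ y ≡ ⟦ m ⟧ y * ⟦ m′ ⟧ y
  zipWith-eval []      []        y = refl
  zipWith-eval (f ∷ m) (g ∷ m′) y = trans
    (cong₂ _*_ (·-eval f g (head y)) (zipWith-eval m m′ (tail y)))
    (interchange (evalFactor f (head y)) (evalFactor g (head y)) (⟦ m ⟧ (tail y)) (⟦ m′ ⟧ (tail y)))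
    where
    interchange : ∀ a b c d → a * b * (c * d) ≡ a * c * (b * d)
    interchange = solve-∀

  zipWith-weight : ∀ {q n} (m m′ : Monomial q n) → weight (zipWith _·_ m m′) ℕ.≤ weight m ℕ.+ weight m′
  zipWith-weight []            []             = z≤n
  zipWith-weight (nothing ∷ m) (nothing ∷ m′) = zipWith-weight m m′
  zipWith-weight (nothing ∷ m) (just g ∷ m′)  = ℕₚ.≤-trans (s≤s (zipWith-weight m m′))
      (ℕₚ.≤-reflexive (sym (ℕₚ.+-suc (weight m) (weight m′))))
  zipWith-weight (just f ∷ m)  (nothing ∷ m′) = s≤s (zipWith-weight m m′)
  zipWith-weight (just f ∷ m)  (just g ∷ m′)  = s≤s
      (ℕₚ.≤-trans (zipWith-weight m m′) (ℕₚ.+-monoʳ-≤ (weight m) (ℕₚ.n≤1+n (weight m′))))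

  -- Degrees are at most additive because factors at a common coordinate merge into one.
  Degree≤-* : ∀ {q n r r′} {f g : Word q n → ℤ} → Degree≤ r f → Degree≤ r′ g → Degree≤ (r ℕ.+ r′)
      λ y → f y * g y
  Degree≤-* (monomial m w≤r) (monomial m′ w′≤r′) = respects (zipWith-eval m m′)
    (monomial (zipWith _·_ m m′) (ℕₚ.≤-trans (zipWith-weight m m′) (ℕₚ.+-mono-≤ w≤r w′≤r′)))
  Degree≤-* df@(monomial m _) zero                = respects (λ y → sym (*-zeroʳ (⟦ m ⟧ y))) zero
  Degree≤-* df@(monomial m _) (plus {g} {h} dg dh) = respects (λ y → sym (*-distribˡ-+ (⟦ m ⟧ y) (g y) (h y)))
      (plus (Degree≤-* df dg) (Degree≤-* df dh))
  Degree≤-* df@(monomial m _) (respects g≗h dg)    = respects (λ y → cong (⟦ m ⟧ y *_) (g≗h y))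
      (Degree≤-* df dg)
  Degree≤-* {g = g} zero dg                        = respects (λ y → sym (*-zeroˡ (g y))) zero
  Degree≤-* {g = g} (plus {f} {f′} df df′) dg      = respects (λ y → sym (*-distribʳ-+ (g y) (f y) (f′ y)))
      (plus (Degree≤-* df dg) (Degree≤-* df′ dg))
  Degree≤-* {g = g} (respects f≗f′ df) dg          = respects (λ y → cong (_* g y) (f≗f′ y)) (Degree≤-* df dg)

-- Krawtchouk kernels and their orthogonality.

module KrawtchoukKernel where

  open import Defs
  open import Data.Nat as ℕ using (ℕ; zero; suc)
  import Data.Nat.Properties as ℕₚ
  open import Data.Integer using (ℤ; +_; -_; _+_; _*_; _-_; _^_; 0ℤ; 1ℤ; NonZero)
  open import Data.Integer.Properties
  open import Data.Integer.Tactic.RingSolver using (solve-∀)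
  open import Data.Fin as F using (Fin; zero; suc; toℕ)
  open import Data.Bool using (if_then_else_)
  open import Data.Vec as Vec using (Vec; []; _∷_; head; tail; zipWith)
  import Data.Vec.Properties as Vecₚ
  open import Data.Maybe using (just; nothing)
  open import Data.Product using (_,_)
  open import Relation.Binary.PropositionalEquality
  open import Relation.Nullary using (yes; no)
  open import Relation.Nullary.Decidable using (⌊_⌋)
  open Sums
  open SymmetricFunctions
  open DesignSums
  open Monomials

  open ≡-Reasoning

  -- As a matrix this is q times the orthogonal projection onto the functions with sum zero on the
  -- alphabet. It equals the sum of the nontrivial characters at a - b, without roots of unity.
  χ : ∀ {q} → Fin q → Fin q → ℤ
  χ {q} a b = + q * δ a b - 1ℤ

  χ-sym : ∀ {q} (a b : Fin q) → χ a b ≡ χ b a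
  χ-sym {q} a b = cong (λ t → + q * t - 1ℤ) (δ-sym a b)

  ∑-χ* : ∀ {q} (a : Fin q) (f : Fin q → ℤ) → ∑ (λ b → χ a b * f b) ≡ + q * f a - ∑ f
  ∑-χ* {q} a f = begin
    ∑ (λ b → χ a b * f b)
      ≡⟨ ∑-cong (λ b → expand (+ q) (δ a b) (f b)) ⟩
    ∑ (λ b → + q * (δ a b * f b) + - 1ℤ * f b)
      ≡⟨ ∑-+ (λ b → + q * (δ a b * f b)) (λ b → - 1ℤ * f b) ⟩
    ∑ (λ b → + q * (δ a b * f b)) + ∑ (λ b → - 1ℤ * f b)
      ≡⟨ cong₂ _+_ (∑-*ˡ (+ q) (λ b → δ a b * f b)) (∑-*ˡ (- 1ℤ) f) ⟨
    + q * ∑ (λ b → δ a b * f b) + - 1ℤ * ∑ f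
      ≡⟨ cong (λ t → + q * t + - 1ℤ * ∑ f) (∑-δ a f) ⟩
    + q * f a + - 1ℤ * ∑ f
      ≡⟨ tidy (+ q * f a) (∑ f) ⟩
    + q * f a - ∑ f ∎
    where
    expand : ∀ q d f → (q * d - 1ℤ) * f ≡ q * (d * f) + - 1ℤ * f
    expand = solve-∀
    tidy : ∀ a b → a + - 1ℤ * b ≡ a - b
    tidy = solve-∀

  ∑-χ : ∀ {q} (a : Fin q) → ∑ (χ a) ≡ 0ℤ
  ∑-χ {q} a = begin
    ∑ (χ a)                              ≡⟨ ∑-cong (λ b → sym (*-identityʳ (χ a b))) ⟩
    ∑ (λ b → χ a b * 1ℤ)                 ≡⟨ ∑-χ* a (λ _ → 1ℤ) ⟩
    + q * 1ℤ - ∑ {q} (λ _ → 1ℤ)          ≡⟨ cong₂ _-_ (*-identityʳ (+ q)) (∑-one q) ⟩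
    + q - + q                            ≡⟨ +-inverseʳ (+ q) ⟩
    0ℤ                                   ∎

  ∑-χχ : ∀ {q} (a b : Fin q) → ∑ (λ c → χ a c * χ b c) ≡ + q * χ a b
  ∑-χχ {q} a b = begin
    ∑ (λ c → χ a c * χ b c) ≡⟨ ∑-χ* a (χ b) ⟩
    + q * χ b a - ∑ (χ b)   ≡⟨ cong₂ (λ s t → + q * s - t) (χ-sym b a) (∑-χ b) ⟩
    + q * χ a b - 0ℤ        ≡⟨ +-identityʳ _ ⟩
    + q * χ a b             ∎

  -- kernel j x y is the value at ∂(x, y) of the Krawtchouk polynomial of degree j,
  -- i.e. the reproducing kernel of the j-th harmonic space.
  kernel : ∀ {q n} → ℕ → Word q n → Word q n → ℤ
  kernel j x y = esym (zipWith χ x y) j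

  kernel-sym : ∀ {q n} j (x y : Word q n) → kernel j x y ≡ kernel j y x
  kernel-sym j x y = cong (λ v → esym v j) (Vecₚ.zipWith-comm χ-sym x y)

  -- The kernel of the preceding degree, with value 0 in degree -1, so that the recursion in the
  -- first coordinate is uniform in `j`.
  kernel⁻ : ∀ {q n} → ℕ → Word q n → Word q n → ℤ
  kernel⁻ zero    x y = 0ℤ
  kernel⁻ (suc j) x y = kernel j x y

  kernel-∷ : ∀ {q n} j a b (x y : Word q n) → kernel j (a ∷ x) (b ∷ y) ≡ kernel j x y + χ a b * kernel⁻ j x y
  kernel-∷ zero    a b x y = sym (trans (cong (λ t → 1ℤ + t) (*-zeroʳ (χ a b))) (+-identityʳ 1ℤ))
  kernel-∷ (suc j) a b x y = refl

  kernel-degree : ∀ {q n} j (x : Word q n) → Degree≤ j (kernel j x)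
  kernel-degree zero    x       = Degree≤-one
  kernel-degree (suc j) []      = respects (λ { [] → refl }) zero
  kernel-degree (suc j) (a ∷ x) = respects
    (λ { (b ∷ y) → cong (_+ χ a b * kernel j x y) (*-identityˡ (kernel (suc j) x y)) })
    (plus (Degree≤-∷ nothing (kernel-degree (suc j) x)) (Degree≤-∷ (just (χ a)) (kernel-degree j x)))

  kron : ℕ → ℕ → ℤ
  kron zero    zero    = 1ℤ
  kron zero    (suc k) = 0ℤ
  kron (suc j) zero    = 0ℤ
  kron (suc j) (suc k) = kron j k

  -- At each coordinate a single `χ` sums to zero and a product of two sums to `q χ`. Hence only the
  -- terms in which both kernels use the coordinate, or neither does, survive. Up to the factor q^n
  -- the kernels are orthogonal idempotents.
  kernel-orthogonal : ∀ {q n} j k (x w : Word q n) →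
    ∑W n (λ y → kernel j x y * kernel k w y) ≡ (+ q) ^ n * (kron j k * kernel j x w)
  kernel-orthogonal zero    zero    [] [] = refl
  kernel-orthogonal zero    (suc k) [] [] = refl
  kernel-orthogonal (suc j) zero    [] [] = refl
  kernel-orthogonal (suc j) (suc k) [] [] = sym (trans (*-identityˡ _) (*-zeroʳ (kron j k)))
  kernel-orthogonal {q} {suc n} j k (a ∷ x) (b ∷ w) = begin
    ∑ (λ c → ∑W n λ y → kernel j (a ∷ x) (c ∷ y) * kernel k (b ∷ w) (c ∷ y))
      ≡⟨ ∑-cong (λ c → trans (∑W-cong n λ y → trans (cong₂ _*_ (kernel-∷ j a c x y) (kernel-∷ k b c w y))
          (expand (kernel j x y) (χ a c) (kernel⁻ j x y) (kernel k w y) (χ b c) (kernel⁻ k w y))) (linear c)) ⟩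
    ∑ (λ c → S + χ a c * S₁ + χ b c * S₂ + χ a c * χ b c * S₃)
      ≡⟨ trans (∑-+ (λ c → S + χ a c * S₁ + χ b c * S₂) _)
          (cong (_+ ∑ (λ c → χ a c * χ b c * S₃)) (trans (∑-+ (λ c → S + χ a c * S₁) _)
          (cong (_+ ∑ (λ c → χ b c * S₂)) (∑-+ (λ _ → S) λ c → χ a c * S₁)))) ⟩
    ∑ {q} (λ _ → S) + ∑ (λ c → χ a c * S₁) + ∑ (λ c → χ b c * S₂) + ∑ (λ c → χ a c * χ b c * S₃)
      ≡⟨ cong₂ _+_ (cong₂ _+_ (cong₂ _+_ constant (killed a S₁)) (killed b S₂))
          (trans (sym (∑-*ʳ S₃ λ c → χ a c * χ b c)) (cong (_* S₃) (∑-χχ a b))) ⟩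
    + q * S + 0ℤ + 0ℤ + + q * χ a b * S₃
      ≡⟨ cong₂ (λ s t → + q * s + 0ℤ + 0ℤ + + q * χ a b * t) (kernel-orthogonal j k x w) (S₃≡ j k) ⟩
    + q * ((+ q) ^ n * (kron j k * kernel j x w)) + 0ℤ + 0ℤ + + q * χ a b *
        ((+ q) ^ n * (kron j k * kernel⁻ j x w))
      ≡⟨ collect (+ q) ((+ q) ^ n) (kron j k) (kernel j x w) (χ a b) (kernel⁻ j x w) ⟩
    + q * (+ q) ^ n * (kron j k * (kernel j x w + χ a b * kernel⁻ j x w))
      ≡⟨ cong (λ t → + q * (+ q) ^ n * (kron j k * t)) (kernel-∷ j a b x w) ⟨
    + q * (+ q) ^ n * (kron j k * kernel j (a ∷ x) (b ∷ w)) ∎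
    where
    S S₁ S₂ S₃ : ℤ
    S  = ∑W n λ y → kernel j x y * kernel k w y
    S₁ = ∑W n λ y → kernel⁻ j x y * kernel k w y
    S₂ = ∑W n λ y → kernel j x y * kernel⁻ k w y
    S₃ = ∑W n λ y → kernel⁻ j x y * kernel⁻ k w y
    expand : ∀ g u g′ h v h′ → (g + u * g′) * (h + v * h′) ≡ g * h + u * (g′ * h) + v * (g * h′) + u * v *
        (g′ * h′)
    expand = solve-∀
    collect : ∀ q p d g c g′ → q * (p * (d * g)) + 0ℤ + 0ℤ + q * c * (p * (d * g′)) ≡ q * p * (d * (g + c * g′))
    collect = solve-∀
    linear : ∀ c → ∑W n (λ y → kernel j x y * kernel k w y + χ a c * (kernel⁻ j x y * kernel k w y) + χ b c *
        (kernel j x y * kernel⁻ k w y) + χ a c * χ b c * (kernel⁻ j x y * kernel⁻ k w y))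
        ≡ S + χ a c * S₁ + χ b c * S₂ + χ a c * χ b c * S₃
    linear c = trans (∑W-+ n _ _) (cong₂ _+_ (trans (∑W-+ n _ _)
        (cong₂ _+_ (trans (∑W-+ n _ _) (cong (λ t → S + t) (sym (∑W-*ˡ n (χ a c) _))))
        (sym (∑W-*ˡ n (χ b c) _)))) (sym (∑W-*ˡ n (χ a c * χ b c) _)))
    constant : ∑ {q} (λ _ → S) ≡ + q * S
    constant = trans (∑-cong λ _ → sym (*-identityˡ S)) (trans (sym (∑-*ʳ S λ _ → 1ℤ)) (cong (_* S) (∑-one q)))
    killed : ∀ a s → ∑ (λ c → χ a c * s) ≡ 0ℤ
    killed a s = trans (sym (∑-*ʳ s (χ a))) (cong (_* s) (∑-χ a))
    S₃≡ : ∀ j k → ∑W n (λ y → kernel⁻ j x y * kernel⁻ k w y) ≡ (+ q) ^ n * (kron j k * kernel⁻ j x w)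
    S₃≡ zero    k       = trans (∑W-zero n) (sym (trans (cong ((+ q) ^ n *_) (*-zeroʳ (kron zero k)))
        (*-zeroʳ ((+ q) ^ n))))
    S₃≡ (suc j) zero    = trans (∑W-cong n λ y → *-zeroʳ (kernel j x y))
        (trans (∑W-zero n) (sym (*-zeroʳ ((+ q) ^ n))))
    S₃≡ (suc j) (suc k) = kernel-orthogonal j k x w

  -- Fixing the first letter costs one degree on top of j + k, whence the bound on `t`. The left
  -- factor `suc q` appears because the words with a given first letter form a fraction 1/q of all
  -- words.
  kernel-block-orthogonal : ∀ {q n t} (C : Code (suc q) (suc n)) → IsDesign t C → ∀ j k → suc (j ℕ.+ k) ℕ.≤ t →
    ∀ b (x w : Word (suc q) n) →
    + suc q * ∑∈ (elems C) (λ y → δ b (head y) * (kernel j x (tail y) * kernel k w (tail y))) ≡ + size C *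
        (kron j k * kernel j x w)
  kernel-block-orthogonal {q} {n} C design j k j+k<t b x w = *-cancelˡ-≡ (Q ^ n) _ _ {{^-nonZero q n}} (begin
    Q ^ n * (Q * ∑∈ (elems C) f)
      ≡⟨ rotate (Q ^ n) Q (∑∈ (elems C) f) ⟩
    Q * Q ^ n * ∑∈ (elems C) f
      ≡⟨ design-average C design (Degree≤-weaken j+k<t
          (Degree≤-∷ (just (δ b)) (Degree≤-* (kernel-degree j x) (kernel-degree k w)))) ⟩
    + size C * ∑W (suc n) f
      ≡⟨ cong (+ size C *_) (trans (∑-cong λ a → sym (∑W-*ˡ n (δ b a) _)) (∑-δ b _)) ⟩
    + size C * ∑W n (λ y → kernel j x y * kernel k w y)
      ≡⟨ cong (+ size C *_) (kernel-orthogonal j k x w) ⟩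
    + size C * (Q ^ n * (kron j k * kernel j x w))
      ≡⟨ swap (+ size C) (Q ^ n) (kron j k * kernel j x w) ⟩
    Q ^ n * (+ size C * (kron j k * kernel j x w)) ∎)
    where
    Q = + suc q
    f : Word (suc q) (suc n) → ℤ
    f y = δ b (head y) * (kernel j x (tail y) * kernel k w (tail y))
    rotate : ∀ a b c → a * (b * c) ≡ b * a * c
    rotate = solve-∀
    swap : ∀ a b c → a * (b * c) ≡ b * (a * c)
    swap = solve-∀

  agreements : ∀ {q n} → Word q n → Word q n → ℕ
  agreements []      []      = 0
  agreements (a ∷ x) (b ∷ y) = (if ⌊ a F.≟ b ⌋ then 1 else 0) ℕ.+ agreements x y

  hamming-agreements : ∀ {q n} (x y : Word q n) → hamming x y ℕ.+ agreements x y ≡ n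
  hamming-agreements []      []      = refl
  hamming-agreements (a ∷ x) (b ∷ y) with a F.≟ b
  ... | yes _ = trans (ℕₚ.+-suc (hamming x y) (agreements x y)) (cong suc (hamming-agreements x y))
  ... | no  _ = cong suc (hamming-agreements x y)

  -- The entries 1 + χ equal q δ: they are `q` at an agreement and 0 elsewhere.
  esym-agreements : ∀ {q n} (x y : Word q n) k → esym (Vec.map (λ z → 1ℤ + z) (zipWith χ x y)) k ≡ scaledBinom q
      (agreements x y) k
  esym-agreements x y zero = refl
  esym-agreements {q} [] [] (suc k) = sym (*-zeroʳ ((+ q) ^ suc k))
  esym-agreements {q} (a ∷ x) (b ∷ y) (suc k) with a F.≟ b
  ... | yes _ = begin
    esym v (suc k) + (1ℤ + (+ q * 1ℤ - 1ℤ)) * esym v k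
      ≡⟨ cong (λ t → esym v (suc k) + t * esym v k) (simplify (+ q)) ⟩
    esym v (suc k) + + q * esym v k
      ≡⟨ cong₂ (λ s t → s + + q * t) (esym-agreements x y (suc k)) (esym-agreements x y k) ⟩
    scaledBinom q (agreements x y) (suc k) + + q * scaledBinom q (agreements x y) k
      ≡⟨ scaledBinom-suc q (agreements x y) k ⟨
    scaledBinom q (suc (agreements x y)) (suc k) ∎
    where
    v = Vec.map (λ z → 1ℤ + z) (zipWith χ x y)
    simplify : ∀ q → 1ℤ + (q * 1ℤ - 1ℤ) ≡ q
    simplify = solve-∀
  ... | no  _ = begin
    esym v (suc k) + (1ℤ + (+ q * 0ℤ - 1ℤ)) * esym v k
      ≡⟨ simplify (esym v (suc k)) (+ q) (esym v k) ⟩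
    esym v (suc k)
      ≡⟨ esym-agreements x y (suc k) ⟩
    scaledBinom q (agreements x y) (suc k) ∎
    where
    v = Vec.map (λ z → 1ℤ + z) (zipWith χ x y)
    simplify : ∀ e q f → e + (1ℤ + (q * 0ℤ - 1ℤ)) * f ≡ e
    simplify = solve-∀

  kernel-expand : ∀ {q n} (x y : Word q n) s k → k ℕ.< s →
    scaledBinom q (agreements x y) k ≡ ∑ λ (j : Fin s) → shiftCoeff n k (toℕ j) * kernel (toℕ j) x y
  kernel-expand x y s k k<s = sym (trans (esym-shift (zipWith χ x y) s k k<s) (esym-agreements x y k))

  kernel-diag : ∀ {q n} (x : Word (suc (suc q)) n) j → j ℕ.≤ n → NonZero (kernel j x x)
  kernel-diag {q} {n} x j j≤n with esym-replicate-pos q n j j≤n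
  ... | e , eq = subst NonZero (sym (trans (cong (λ v → esym v j) (diag x)) eq)) _
    where
    value : ∀ c → + suc (suc c) * 1ℤ - 1ℤ ≡ + suc c
    value c = cong (_- 1ℤ) (*-identityʳ (+ suc (suc c)))
    diag : ∀ {n} (x : Word (suc (suc q)) n) → zipWith χ x x ≡ Vec.replicate n (+ suc q)
    diag []      = refl
    diag (a ∷ x) = cong₂ _∷_ (trans (cong (λ t → + suc (suc q) * t - 1ℤ) (δ-refl a)) (value q)) (diag x)

-- Integral eigenvalues between different blocks.

module CrossBlocks where

  open import Defs
  open import Data.Nat as ℕ using (ℕ; zero; suc; s≤s)
  import Data.Nat.Properties as ℕₚ
  open import Data.Integer using (ℤ; +_; -_; _+_; _*_; _-_; _^_; 0ℤ; 1ℤ; NonZero; ≢-nonZero)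
  open import Data.Integer.Properties
  open import Data.Integer.Divisibility.Signed using (_∣_; divides; ∣m∣n⇒∣m+n; ∣n⇒∣m*n; *-monoʳ-∣)
  open import Data.Integer.Tactic.RingSolver using (solve-∀)
  open import Data.Fin as F using (Fin; zero; suc; toℕ; punchIn; punchOut)
  import Data.Fin.Properties as Finₚ
  open import Data.List using (List; []; _∷_)
  open import Data.List.Membership.Propositional using (_∈_)
  open import Data.List.Relation.Unary.Any using (here; there)
  open import Data.Vec using (head; tail)
  open import Data.Vec.Functional using (Vector)
  open import Data.Product using (_,_; ∃; proj₁)
  open import Relation.Binary.PropositionalEquality
  open import Relation.Nullary using (yes; no)
  open import Relation.Nullary.Decidable using (⌊_⌋)
  open import Function using (_∘_)
  open import Function.Definitions using (Injective)
  open Sums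
  open Determinant
  open Powers
  open SymmetricFunctions
  open Vandermonde
  open DesignSums
  open Monomials
  open KrawtchoukKernel

  open ≡-Reasoning

  ∑-kron : ∀ {s} (j : Fin s) (f : Vector ℤ s) → ∑ (λ i → f i * kron (toℕ i) (toℕ j)) ≡ f j
  ∑-kron zero f = begin
    ∑ (λ i → f i * kron (toℕ i) 0)
      ≡⟨ ∑-suc _ ⟩
    f zero * 1ℤ + ∑ (λ i → f (suc i) * 0ℤ)
      ≡⟨ cong₂ _+_ (*-identityʳ (f zero)) (∑-zero λ i → *-zeroʳ (f (suc i))) ⟩
    f zero + 0ℤ
      ≡⟨ +-identityʳ (f zero) ⟩
    f zero ∎
  ∑-kron (suc j) f = begin
    ∑ (λ i → f i * kron (toℕ i) (suc (toℕ j)))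
      ≡⟨ ∑-suc _ ⟩
    f zero * 0ℤ + ∑ (λ i → f (suc i) * kron (toℕ i) (toℕ j))
      ≡⟨ cong₂ _+_ (*-zeroʳ (f zero)) (∑-kron j (f ∘ suc)) ⟩
    0ℤ + f (suc j)
      ≡⟨ +-identityˡ (f (suc j)) ⟩
    f (suc j) ∎

  ∏-nonZero : ∀ {n} (f : Vector ℤ n) → (∀ i → NonZero (f i)) → NonZero (∏ f)
  ∏-nonZero {zero}  f f≢0 = _
  ∏-nonZero {suc n} f f≢0 = i*j≢0 (f zero) (∏ (f ∘ suc)) {{f≢0 zero}} {{∏-nonZero (f ∘ suc) (f≢0 ∘ suc)}}

  ∣-∑∈ : ∀ {A : Set} d (xs : List A) {f : A → ℤ} → (∀ {x} → x ∈ xs → d ∣ f x) → d ∣ ∑∈ xs f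
  ∣-∑∈ d []       d∣f = divides 0ℤ refl
  ∣-∑∈ d (x ∷ xs) d∣f = ∣m∣n⇒∣m+n (d∣f (here refl)) (∣-∑∈ d xs (d∣f ∘ there))

  -- The parameters are shifted: alphabet size q + 2, length n + 1, degree s + 1. The degree set
  -- enters only through `cross`, for words with different first letters.
  module Blocks (q n s : ℕ) (C : Code (suc (suc q)) (suc n)) (design : IsDesign (2 ℕ.* suc s ℕ.∸ 1) C)
    (g : Fin (suc s) → ℕ) (g-injective : Injective _≡_ _≡_ g)
    (cross : ∀ {x y} → x ∈ elems C → y ∈ elems C → head x ≢ head y → ∃ λ l → agreements (tail x) (tail y) ≡ g l)
    where

    Letter Tail : Set
    Letter = Fin (suc (suc q))
    Tail   = Word (suc (suc q)) n

    Q N : ℤ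
    Q = + suc (suc q)
    N = + size C

    -- Indices are at most `s`, and s + s + 1 is exactly the strength 2 (s + 1) - 1.
    degree-bound : (i j : Fin (suc s)) → suc (toℕ i ℕ.+ toℕ j) ℕ.≤ 2 ℕ.* suc s ℕ.∸ 1
    degree-bound i j = ℕₚ.≤-trans (s≤s (ℕₚ.+-mono-≤ (ℕₚ.≤-pred (Finₚ.toℕ<n i)) (ℕₚ.≤-pred (Finₚ.toℕ<n j))))
      (ℕₚ.≤-reflexive (trans (sym (ℕₚ.+-suc s s)) (cong (λ t → s ℕ.+ suc t) (sym (ℕₚ.+-identityʳ s)))))

    opaque
      block : Letter → (Tail → ℤ) → ℤ
      block b f = ∑∈ (elems C) λ y → δ b (head y) * f (tail y)

      block-cong : ∀ b {f f′ : Tail → ℤ} → (∀ {y} → y ∈ elems C → head y ≡ b → f (tail y) ≡ f′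
          (tail y)) → block b f ≡ block b f′
      block-cong b {f} {f′} f≗f′ = ∑∈-cong (elems C) λ {y} y∈C → term y y∈C
        where
        term : ∀ y → y ∈ elems C → δ b (head y) * f (tail y) ≡ δ b (head y) * f′ (tail y)
        term y y∈C with b F.≟ head y
        ... | yes b≡h = cong (1ℤ *_) (f≗f′ y∈C (sym b≡h))
        ... | no  _   = refl

      block-*ˡ : ∀ b c (f : Tail → ℤ) → block b (λ y → c * f y) ≡ c * block b f
      block-*ˡ b c f = trans (∑∈-cong (elems C) λ {y} _ → swap (δ b (head y)) c (f (tail y)))
          (sym (∑∈-*ˡ (elems C) c λ y → δ b (head y) * f (tail y)))
        where
        swap : ∀ d c f → d * (c * f) ≡ c * (d * f)
        swap = solve-∀

      block-∑ : ∀ {m} b (c : Vector ℤ m) (f : Fin m → Tail → ℤ) (h : Tail → ℤ) →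
        block b (λ y → ∑ (λ i → c i * f i y) * h y) ≡ ∑ λ i → c i * block b λ y → f i y * h y
      block-∑ b c f h = begin
        block b (λ y → ∑ (λ i → c i * f i y) * h y)
          ≡⟨ ∑∈-cong (elems C) (λ {y} _ → trans (cong (δ b (head y) *_)
              (∑-*ʳ (h (tail y)) λ i → c i * f i (tail y))) (∑-*ˡ (δ b (head y)) _)) ⟩
        ∑∈ (elems C) (λ y → ∑ λ i → δ b (head y) * (c i * f i (tail y) * h (tail y)))
          ≡⟨ ∑∈-∑ (elems C) _ ⟩
        ∑ (λ i → block b λ y → c i * f i y * h y)
          ≡⟨ ∑-cong (λ i → trans (∑∈-cong (elems C) λ {y} _ → cong (δ b (head y) *_)
              (*-assoc (c i) (f i (tail y)) (h (tail y)))) (block-*ˡ b (c i) λ y → f i y * h y)) ⟩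
        ∑ (λ i → c i * block b λ y → f i y * h y) ∎

      kernel-block : ∀ b (i j : Fin (suc s)) (x w : Tail) →
        Q * block b (λ y → kernel (toℕ i) x y * kernel (toℕ j) w y) ≡ N *
            (kron (toℕ i) (toℕ j) * kernel (toℕ i) x w)
      kernel-block b i j x w = kernel-block-orthogonal C design (toℕ i) (toℕ j) (degree-bound i j) b x w

      block-∣ : ∀ d b {f : Tail → ℤ} → (∀ {y} → y ∈ elems C → d ∣ f (tail y)) → d ∣ block b f
      block-∣ d b d∣f = ∣-∑∈ d (elems C) λ {y} y∈C → ∣n⇒∣m*n (δ b (head y)) (d∣f y∈C)

    A : Matrix (suc s) (suc s)
    A k j = shiftCoeff n (toℕ k) (toℕ j)

    -- After the scaled binomial is expanded in the kernels, orthogonality on the block leaves only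
    -- the summand of index `j`.
    binom-block : ∀ b k j (x w : Tail) →
      Q * block b (λ y → scaledBinom (suc (suc q)) (agreements x y) (toℕ k) * kernel (toℕ j) w y) ≡ N *
          (A k j * kernel (toℕ j) x w)
    binom-block b k j x w = begin
      Q * block b (λ y → scaledBinom (suc (suc q)) (agreements x y) (toℕ k) * kernel (toℕ j) w y)
        ≡⟨ cong (Q *_) (block-cong b λ {y} _ _ → cong (_* kernel (toℕ j) w (tail y))
            (kernel-expand x (tail y) (suc s) (toℕ k) (Finₚ.toℕ<n k))) ⟩
      Q * block b (λ y → ∑ (λ i → A k i * kernel (toℕ i) x y) * kernel (toℕ j) w y)
        ≡⟨ cong (Q *_) (block-∑ b (A k) (λ i → kernel (toℕ i) x) (kernel (toℕ j) w)) ⟩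
      Q * ∑ (λ i → A k i * block b λ y → kernel (toℕ i) x y * kernel (toℕ j) w y)
        ≡⟨ ∑-*ˡ Q _ ⟩
      ∑ (λ i → Q * (A k i * block b λ y → kernel (toℕ i) x y * kernel (toℕ j) w y))
        ≡⟨ ∑-cong (λ i → trans (swap Q (A k i) _) (trans (cong (A k i *_) (kernel-block b i j x w))
            (regroup (A k i) N (kron (toℕ i) (toℕ j)) (kernel (toℕ i) x w)))) ⟩
      ∑ (λ i → N * (A k i * kernel (toℕ i) x w) * kron (toℕ i) (toℕ j))
        ≡⟨ ∑-kron j (λ i → N * (A k i * kernel (toℕ i) x w)) ⟩
      N * (A k j * kernel (toℕ j) x w) ∎
      where
      swap : ∀ a b c → a * (b * c) ≡ b * (a * c)
      swap = solve-∀
      regroup : ∀ a n d k → a * (n * (d * k)) ≡ n * (a * k) * d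
      regroup = solve-∀

    polynomial-block : ∀ (τ : Vector ℤ (suc s)) b j (x w : Tail) →
      Q * block b (λ y → ∑ (λ k → τ k * scaledBinom (suc (suc q)) (agreements x y) (toℕ k)) * kernel
          (toℕ j) w y)
      ≡ N * ∑ (λ k → τ k * A k j) * kernel (toℕ j) x w
    polynomial-block τ b j x w = begin
      Q * block b (λ y → ∑ (λ k → τ k * β k y) * kernel (toℕ j) w y)
        ≡⟨ cong (Q *_) (block-∑ b τ β (kernel (toℕ j) w)) ⟩
      Q * ∑ (λ k → τ k * block b λ y → β k y * kernel (toℕ j) w y)
        ≡⟨ ∑-*ˡ Q _ ⟩
      ∑ (λ k → Q * (τ k * block b λ y → β k y * kernel (toℕ j) w y))
        ≡⟨ ∑-cong (λ k → trans (swap Q (τ k) _) (trans (cong (τ k *_) (binom-block b k j x w))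
            (regroup (τ k) N (A k j) K))) ⟩
      ∑ (λ k → N * K * (τ k * A k j))
        ≡⟨ ∑-*ˡ (N * K) _ ⟨
      N * K * ∑ (λ k → τ k * A k j)
        ≡⟨ rotate N K _ ⟩
      N * ∑ (λ k → τ k * A k j) * K ∎
      where
      K = kernel (toℕ j) x w
      β : Fin (suc s) → Tail → ℤ
      β k y = scaledBinom (suc (suc q)) (agreements x y) (toℕ k)
      swap : ∀ a b c → a * (b * c) ≡ b * (a * c)
      swap = solve-∀
      regroup : ∀ t n a k → t * (n * (a * k)) ≡ n * k * (t * a)
      regroup = solve-∀
      rotate : ∀ a b c → a * b * c ≡ a * c * b
      rotate = solve-∀

    others : Fin (suc s) → Vector ℤ s
    others l i = + g (punchIn l i)

    -- The denominator of the Lagrange polynomial at the node `g l`. The factor `Q ^ s` makes the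
    -- coefficients of its numerator integral in the scaled binomials.
    D : Fin (suc s) → ℤ
    D l = Q ^ s * ∏ λ i → + g l - others l i

    D-nonZero : ∀ l → NonZero (D l)
    D-nonZero l = i*j≢0 (Q ^ s) (∏ λ i → + g l - others l i) {{^-nonZero (suc q) s}}
      {{∏-nonZero _ λ i → ≢-nonZero λ eq → Finₚ.punchInᵢ≢i l i
          (sym (g-injective (+-injective (i-j≡0⇒i≡j (+ g l) (others l i) eq))))}}

    match : Fin (suc s) → ℕ → ℤ
    match l v = indicator ⌊ g l ℕ.≟ v ⌋

    match-δ : ∀ l m → match l (g m) ≡ δ m l
    match-δ l m with g l ℕ.≟ g m
    ... | yes gl≡gm = sym (trans (cong (δ m) (g-injective gl≡gm)) (δ-refl m))
    ... | no  gl≢gm = sym (δ-≢ λ m≡l → gl≢gm (cong g (sym m≡l)))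

    lagrange : ∀ l m → Q ^ s * ∏ (λ i → + g m - others l i) ≡ D l * match l (g m)
    lagrange l m with g l ℕ.≟ g m
    ... | yes gl≡gm = trans (cong (λ v → Q ^ s * ∏ (λ i → + v - others l i)) (sym gl≡gm))
        (sym (*-identityʳ (D l)))
    ... | no  gl≢gm = trans
      (cong (Q ^ s *_) (∏-zero (λ i → + g m - others l i) (punchOut l≢m)
          (trans (cong (λ k → + g m - + g k) (Finₚ.punchIn-punchOut l≢m)) (+-inverseʳ (+ g m)))))
      (trans (*-zeroʳ (Q ^ s)) (sym (*-zeroʳ (D l))))
      where
      l≢m : l ≢ m
      l≢m l≡m = gl≢gm (cong g l≡m)

    -- Coefficients of the cleared Lagrange polynomial in the kernels, reached through the scaled
    -- binomials. The eigenvalue of `match l` on the j-th kernel is then `N * u l j` over `Q * D l`.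
    u : Matrix (suc s) (suc s)
    u l j = ∑ λ k → binomCoeff (suc (suc q)) (others l) (toℕ k) * A k j

    -- Between different blocks the number of agreements is always one of the nodes, so
    -- `D l * match l` coincides there with a polynomial of degree s, to which `polynomial-block`
    -- applies. Within the block of `x` this can fail, hence `head x ≢ b`.
    match-block : ∀ l j {x} → x ∈ elems C → ∀ b → head x ≢ b → ∀ w →
      Q * D l * block b (λ y → match l (agreements (tail x) y) * kernel (toℕ j) w y) ≡ N * u l j * kernel
          (toℕ j) (tail x) w
    match-block l j {x} x∈C b h≢b w = begin
      Q * D l * block b (λ y → match l (agreements (tail x) y) * kernel (toℕ j) w y)
        ≡⟨ trans (*-assoc Q (D l) _) (cong (Q *_) (sym (block-*ˡ b (D l) _))) ⟩
      Q * block b (λ y → D l * (match l (agreements (tail x) y) * kernel (toℕ j) w y))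
        ≡⟨ cong (Q *_) (block-cong b λ {y} y∈C h≡b → trans
            (sym (*-assoc (D l) (match l (agreements (tail x) (tail y))) _))
            (cong (_* kernel (toℕ j) w (tail y)) (interpolate y∈C h≡b))) ⟩
      Q * block b (λ y → ∑ (λ k → binomCoeff (suc (suc q)) (others l) (toℕ k) * scaledBinom (suc (suc q))
          (agreements (tail x) y) (toℕ k)) * kernel (toℕ j) w y)
        ≡⟨ polynomial-block (λ k → binomCoeff (suc (suc q)) (others l) (toℕ k)) b j (tail x) w ⟩
      N * u l j * kernel (toℕ j) (tail x) w ∎
      where
      interpolate : ∀ {y} → y ∈ elems C → head y ≡ b → D l * match l (agreements (tail x) (tail y)) ≡
        ∑ λ (k : Fin (suc s)) → binomCoeff (suc (suc q)) (others l) (toℕ k) * scaledBinom (suc (suc q))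
            (agreements (tail x) (tail y)) (toℕ k)
      interpolate {y} y∈C h≡b with cross x∈C y∈C (λ hx≡hy → h≢b (trans hx≡hy h≡b))
      ... | m , agr≡gm = begin
        D l * match l (agreements (tail x) (tail y))
          ≡⟨ cong (λ v → D l * match l v) agr≡gm ⟩
        D l * match l (g m)
          ≡⟨ lagrange l m ⟨
        Q ^ s * ∏ (λ i → + g m - others l i)
          ≡⟨ binomCoeff-expand (suc (suc q)) (others l) (suc s) (g m) ℕₚ.≤-refl ⟩
        ∑ (λ (k : Fin (suc s)) → binomCoeff (suc (suc q)) (others l) (toℕ k) * scaledBinom (suc (suc q)) (g m)
            (toℕ k))
          ≡⟨ cong (λ v → ∑ λ (k : Fin (suc s)) → binomCoeff (suc (suc q)) (others l) (toℕ k) * scaledBinom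
              (suc (suc q)) v (toℕ k)) agr≡gm ⟨
        ∑ (λ (k : Fin (suc s)) → binomCoeff (suc (suc q)) (others l) (toℕ k) * scaledBinom (suc (suc q))
            (agreements (tail x) (tail y)) (toℕ k)) ∎

    other : Letter → Letter
    other a = punchIn a zero

    -- The integral matrix [match l] maps block to block with eigenvalue N u / (Q D),
    -- so iterating it never produces new denominators.
    powers-divide : ∀ l j m {x} → x ∈ elems C → ∀ w → (Q * D l) ^ m ∣ (N * u l j) ^ m * kernel (toℕ j)
        (tail x) w
    powers-divide l j zero x∈C w = divides (1ℤ * kernel (toℕ j) _ w) (sym (*-identityʳ _))
    powers-divide l j (suc m) {x} x∈C w = subst ((Q * D l) ^ suc m ∣_) (sym expand)
        (*-monoʳ-∣ (Q * D l) (block-∣ ((Q * D l) ^ m) b λ {y} y∈C →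
      ∣n⇒∣m*n (match l (agreements (tail x) (tail y)))
          (subst (λ t → (Q * D l) ^ m ∣ U ^ m * t) (kernel-sym (toℕ j) (tail y) w)
          (powers-divide l j m y∈C w))))
      where
      U = N * u l j
      -- Any block other than that of `x` would do; the induction hypothesis is then used at the
      -- words of the code, which may sit in any block.
      b = other (head x)
      expand : U ^ suc m * kernel (toℕ j) (tail x) w ≡ Q * D l * block b λ y → match l (agreements (tail x) y) *
          (U ^ m * kernel (toℕ j) w y)
      expand = begin
        U * U ^ m * kernel (toℕ j) (tail x) w
          ≡⟨ rotate U (U ^ m) (kernel (toℕ j) (tail x) w) ⟩
        U ^ m * (U * kernel (toℕ j) (tail x) w)
          ≡⟨ cong (U ^ m *_) (match-block l j x∈C b (Finₚ.punchInᵢ≢i (head x) zero ∘ sym) w) ⟨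
        U ^ m * (Q * D l * block b λ y → match l (agreements (tail x) y) * kernel (toℕ j) w y)
          ≡⟨ swap (U ^ m) (Q * D l) _ ⟩
        Q * D l * (U ^ m * block b λ y → match l (agreements (tail x) y) * kernel (toℕ j) w y)
          ≡⟨ cong (Q * D l *_) (trans (sym (block-*ˡ b (U ^ m) _))
              (block-cong b λ {y} _ _ → swap (U ^ m) (match l (agreements (tail x) (tail y)))
              (kernel (toℕ j) w (tail y)))) ⟩
        Q * D l * block b (λ y → match l (agreements (tail x) y) * (U ^ m * kernel (toℕ j) w y)) ∎
        where
        rotate : ∀ a b c → a * b * c ≡ b * (a * c)
        rotate = solve-∀
        swap : ∀ a b c → a * (b * c) ≡ b * (a * c)
        swap = solve-∀

    Bin : Matrix (suc s) (suc s)
    Bin = binomMatrix (suc (suc q)) g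

    -- The strength cannot exceed the length. This makes the diagonal values of all kernels in use
    -- nonzero.
    s≤n : s ℕ.≤ n
    s≤n = ℕₚ.≤-pred (ℕₚ.≤-trans (ℕₚ.≤-trans (ℕₚ.m≤m+n (suc s) s)
        (ℕₚ.≤-reflexive (trans (sym (ℕₚ.+-suc s s)) (cong (λ t → s ℕ.+ suc t) (sym (ℕₚ.+-identityʳ s))))))
        (proj₁ design))

    module _ {x₀} (x₀∈C : x₀ ∈ elems C) where

      K : Fin (suc s) → ℤ
      K j = kernel (toℕ j) (tail x₀) (tail x₀)

      K-nonZero : ∀ j → NonZero (K j)
      K-nonZero j = kernel-diag (tail x₀) (toℕ j) (ℕₚ.≤-trans (ℕₚ.≤-pred (Finₚ.toℕ<n j)) s≤n)

      QD-nonZero : ∀ l → NonZero (Q * D l)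
      QD-nonZero l = i*j≢0 Q (D l) {{_}} {{D-nonZero l}}

      -- With w = `tail x₀` the factor multiplying the m-th power is `K j` for every m: one nonzero
      -- integer that clears the denominators of all powers.
      QD∣Nu : ∀ l j → Q * D l ∣ N * u l j
      QD∣Nu l j = powers-∣⇒∣ℤ (Q * D l) (N * u l j) (K j) {{QD-nonZero l}} {{K-nonZero j}}
          λ m → powers-divide l j m x₀∈C (tail x₀)

      p : Matrix (suc s) (suc s)
      p l j = _∣_.quotient (QD∣Nu l j)

      b₀ : Letter
      b₀ = other (head x₀)

      h≢b₀ : head x₀ ≢ b₀
      h≢b₀ = Finₚ.punchInᵢ≢i (head x₀) zero ∘ sym

      p-eigenvalue : ∀ l j → block b₀ (λ y → match l (agreements (tail x₀) y) * kernel (toℕ j) (tail x₀) y)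
          ≡ p l j * K j
      p-eigenvalue l j = *-cancelˡ-≡ (Q * D l) _ _ {{QD-nonZero l}} (begin
        Q * D l * block b₀ (λ y → match l (agreements (tail x₀) y) * kernel (toℕ j) (tail x₀) y)
          ≡⟨ match-block l j x₀∈C b₀ h≢b₀ (tail x₀) ⟩
        N * u l j * K j
          ≡⟨ cong (_* K j) (_∣_.equality (QD∣Nu l j)) ⟩
        p l j * (Q * D l) * K j
          ≡⟨ rotate (p l j) (Q * D l) (K j) ⟩
        Q * D l * (p l j * K j) ∎)
        where
        rotate : ∀ a b c → a * b * c ≡ b * (a * c)
        rotate = solve-∀

      -- Weighting the matrices `match l` by `Bin k l` recovers the scaled binomial of the number of
      -- agreements across blocks. Its action on the j-th kernel is then known twice, through `p`
      -- and through `binom-block`.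
      Bin-p : ∀ k j → Q * (Bin ⊗ p) k j ≡ N * A k j
      Bin-p k j = *-cancelʳ-≡ _ _ (K j) {{K-nonZero j}} (begin
        Q * ∑ (λ l → Bin k l * p l j) * K j
          ≡⟨ trans (*-assoc Q (∑ λ l → Bin k l * p l j) (K j))
              (cong (Q *_) (trans (∑-*ʳ (K j) λ l → Bin k l * p l j)
              (∑-cong λ l → trans (*-assoc (Bin k l) (p l j) (K j))
              (cong (Bin k l *_) (sym (p-eigenvalue l j)))))) ⟩
        Q * ∑ (λ l → Bin k l * block b₀ λ y → match l (agreements (tail x₀) y) * kernel (toℕ j) (tail x₀) y)
          ≡⟨ cong (Q *_) (block-∑ b₀ (Bin k) (λ l y → match l (agreements (tail x₀) y))
              (kernel (toℕ j) (tail x₀))) ⟨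
        Q * block b₀ (λ y → ∑ (λ l → Bin k l * match l (agreements (tail x₀) y)) * kernel (toℕ j) (tail x₀) y)
          ≡⟨ cong (Q *_) (block-cong b₀ λ {y} y∈C h≡b → cong (_* kernel (toℕ j) (tail x₀) (tail y))
              (select y∈C h≡b)) ⟩
        Q * block b₀ (λ y → scaledBinom (suc (suc q)) (agreements (tail x₀) y) (toℕ k) * kernel (toℕ j)
            (tail x₀) y)
          ≡⟨ binom-block b₀ k j (tail x₀) (tail x₀) ⟩
        N * (A k j * K j)
          ≡⟨ *-assoc N (A k j) (K j) ⟨
        N * A k j * K j ∎)
        where
        select : ∀ {y} → y ∈ elems C → head y ≡ b₀ →
          ∑ (λ l → Bin k l * match l (agreements (tail x₀) (tail y))) ≡ scaledBinom (suc (suc q))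
              (agreements (tail x₀) (tail y)) (toℕ k)
        select {y} y∈C h≡b with cross x₀∈C y∈C (λ hx≡hy → h≢b₀ (trans hx≡hy h≡b))
        ... | m , agr≡gm rewrite agr≡gm = trans (∑-cong λ l → trans (cong (Bin k l *_) (match-δ l m))
            (*-comm (Bin k l) (δ m l))) (∑-δ m (Bin k))

      det-p : Q ^ suc s * (det Bin * det p) ≡ N ^ suc s
      det-p = begin
        Q ^ suc s * (det Bin * det p)
          ≡⟨ cong₂ _*_ (sym (∏-const (suc s) Q)) (sym (det-⊗ Bin p)) ⟩
        ∏ {suc s} (λ _ → Q) * det (Bin ⊗ p)
          ≡⟨ det-scale (λ _ → Q) (Bin ⊗ p) ⟨
        det (λ k j → Q * (Bin ⊗ p) k j)
          ≡⟨ det-cong Bin-p ⟩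
        det (λ k j → N * A k j)
          ≡⟨ det-scale (λ _ → N) A ⟩
        ∏ {suc s} (λ _ → N) * det A
          ≡⟨ cong₂ _*_ (∏-const (suc s) N) (trans (det-lower A λ k<j → shiftCoeff-upper n k<j)
              (∏-one {suc s} λ k → shiftCoeff-diag n (toℕ k))) ⟩
        N ^ suc s * 1ℤ
          ≡⟨ *-identityʳ (N ^ suc s) ⟩
        N ^ suc s ∎

-- From the degree set to the factorization of a power of the code size.

module Factorization where

  open import Defs
  open import Data.Nat as ℕ using (ℕ; suc)
  import Data.Nat.Properties as ℕₚ
  open import Data.Nat.DivMod using (_/_)
  import Data.Nat.Divisibility as ℕ∣
  import Data.Nat.Tactic.RingSolver as ℕ-Solver
  open import Data.Integer using (ℤ; +_; -[1+_]; _+_; _*_; _-_; _^_; ∣_∣)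
  open import Data.Integer.Properties
  open import Data.Integer.Tactic.RingSolver using (solve-∀)
  open import Data.Fin as F using (Fin)
  open import Data.Bool using (if_then_else_)
  open import Data.List using (List; []; _∷_)
  open import Data.List.Membership.Propositional using (_∈_)
  open import Data.List.Relation.Unary.Any using (here)
  open import Data.Vec using ([]; _∷_; head; tail)
  open import Data.Product using (_×_; _,_; ∃; proj₂)
  open import Relation.Binary.PropositionalEquality
  open import Relation.Nullary using (yes; no; contradiction)
  open import Relation.Nullary.Decidable using (⌊_⌋)
  open import Function.Definitions using (Injective)
  open import Function.Bundles using (_⇔_; Equivalence)
  open Determinant
  open Powers
  open Vandermonde
  open KrawtchoukKernel
  open CrossBlocks

  open ≡-Reasoning

  ∃∈ : ∀ {A : Set} (xs : List A) → xs ≢ [] → ∃ (_∈ xs)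
  ∃∈ []       xs≢[] = contradiction refl xs≢[]
  ∃∈ (x ∷ xs) xs≢[] = x , here refl

  pos-abs² : ∀ i → + (∣ i ∣ ℕ.* ∣ i ∣) ≡ i * i
  pos-abs² (+ m)    = pos-* m m
  pos-abs² -[1+ m ] = refl

  agreements-tail : ∀ {q n} (x y : Word q (suc n)) → head x ≢ head y → agreements (tail x) (tail y)
      ≡ agreements x y
  agreements-tail (a ∷ x) (b ∷ y) a≢b with a F.≟ b
  ... | yes a≡b = contradiction a≡b a≢b
  ... | no  _   = refl

  hamming≤ : ∀ {q n} (x y : Word q n) → hamming x y ℕ.≤ n
  hamming≤ x y = ℕₚ.≤-trans (ℕₚ.m≤m+n (hamming x y) (agreements x y)) (ℕₚ.≤-reflexive (hamming-agreements x y))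

  module _ {q n s} (C : Code q (suc n)) (α : Fin s → ℕ)
    (degrees : ∀ d → InDegreeSet C d ⇔ ∃ λ i → α i ≡ d) where

    -- Every αᵢ is attained as a distance. Therefore the truncated subtraction in `codegree` is a
    -- true one, and injectivity passes from `α` to `codegree`.
    α≤n : ∀ i → α i ℕ.≤ suc n
    α≤n i with Equivalence.from (degrees (α i)) (i , refl)
    ... | x , y , _ , _ , _ , ∂≡α = subst (ℕ._≤ suc n) ∂≡α (hamming≤ x y)

    codegree : Fin s → ℕ
    codegree i = suc n ℕ.∸ α i

    codegree-injective : Injective _≡_ _≡_ α → Injective _≡_ _≡_ codegree
    codegree-injective α-injective {i} {j} eq = α-injective (ℕₚ.∸-cancelˡ-≡ (α≤n i) (α≤n j) eq)

    codegree-cross : ∀ {x y} → x ∈ elems C → y ∈ elems C → head x ≢ head y → ∃ λ l → agreements (tail x)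
        (tail y) ≡ codegree l
    codegree-cross {x} {y} x∈C y∈C h≢h with Equivalence.to (degrees (hamming x y))
        (x , y , x∈C , y∈C , (λ x≡y → h≢h (cong head x≡y)) , refl)
    ... | l , α≡∂ = l , (begin
      agreements (tail x) (tail y)                          ≡⟨ agreements-tail x y h≢h ⟩
      agreements x y                                        ≡⟨ ℕₚ.m+n∸m≡n (hamming x y) (agreements x y) ⟨
      (hamming x y ℕ.+ agreements x y) ℕ.∸ hamming x y      ≡⟨ cong₂ ℕ._∸_ (hamming-agreements x y) (sym α≡∂) ⟩
      codegree l                                            ∎)

    pos-codegree : ∀ i → + codegree i ≡ + suc n - + α i
    pos-codegree i = begin
      + codegree i                     ≡⟨ add-sub (+ codegree i) (+ α i) ⟩
      (+ codegree i + + α i) - + α i   ≡⟨ cong (_- + α i) (pos-+ (codegree i) (α i)) ⟨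
      + (codegree i ℕ.+ α i) - + α i   ≡⟨ cong (λ t → + t - + α i) (ℕₚ.m∸n+n≡m (α≤n i)) ⟩
      + suc n - + α i                  ∎
      where
      add-sub : ∀ a b → a ≡ (a + b) - b
      add-sub = solve-∀

    differences-codegree : differences (λ i → + codegree i) ≡ vandermonde α
    differences-codegree = ∏-cong λ i → ∏-cong λ j → cong (λ t → if ⌊ i F.<? j ⌋ then t else + 1) (begin
      + codegree j - + codegree i                 ≡⟨ cong₂ _-_ (pos-codegree j) (pos-codegree i) ⟩
      (+ suc n - + α j) - (+ suc n - + α i)       ≡⟨ cancel (+ suc n) (+ α j) (+ α i) ⟩
      + α i - + α j                               ∎)
      where
      cancel : ∀ n a b → (n - a) - (n - b) ≡ b - a
      cancel = solve-∀

  -- `W` is the determinant of the scaled binomial matrix at the codegrees and `P` that of the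
  -- integral eigenvalue matrix. The first equation states the Vandermonde quotient without
  -- dividing; the second takes absolute values, as the final divisibility is one of natural
  -- numbers.
  frame-factorization : ∀ {q n s} (C : Code (suc (suc q)) (suc n)) → IsDesign (2 ℕ.* suc s ℕ.∸ 1) C →
    (α : Fin (suc s) → ℕ) → Injective _≡_ _≡_ α → (∀ d → InDegreeSet C d ⇔ ∃ λ i → α i ≡ d) →
    ∃ λ W → ∃ λ P →
      + superfact (suc s) * W ≡ + (suc (suc q) ℕ.^ ((suc s ℕ.* s) / 2)) * vandermonde α
      × size C ℕ.^ suc s ≡ suc (suc q) ℕ.^ suc s ℕ.* (∣ W ∣ ℕ.* ∣ P ∣)
  frame-factorization {q} {n} {s} C design α α-injective degrees = W , P , superfact-W , size-C
    where
    g = codegree C α degrees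
    open Blocks q n s C design g (codegree-injective C α degrees α-injective) (codegree-cross C α degrees)
    x₀∈C = proj₂ (∃∈ (elems C) (nonempty C))

    W P : ℤ
    W = det Bin
    P = det (p x₀∈C)

    superfact-W : + superfact (suc s) * W ≡ + (suc (suc q) ℕ.^ ((suc s ℕ.* s) / 2)) * vandermonde α
    superfact-W = begin
      + superfact (suc s) * W
        ≡⟨ det-binomMatrix (suc (suc q)) g ⟩
      Q ^ triangular (suc s) * differences (λ i → + g i)
        ≡⟨ cong (_* differences (λ i → + g i)) (pos-^ (suc (suc q)) (triangular (suc s))) ⟨
      + (suc (suc q) ℕ.^ triangular (suc s)) * differences (λ i → + g i)
        ≡⟨ cong₂ (λ k d → + (suc (suc q) ℕ.^ k) * d) (sym (triangular-/2 (suc s)))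
            (differences-codegree C α degrees) ⟩
      + (suc (suc q) ℕ.^ ((suc s ℕ.* s) / 2)) * vandermonde α ∎

    size-C : size C ℕ.^ suc s ≡ suc (suc q) ℕ.^ suc s ℕ.* (∣ W ∣ ℕ.* ∣ P ∣)
    size-C = begin
      size C ℕ.^ suc s                              ≡⟨ abs-^ N (suc s) ⟨
      ∣ N ^ suc s ∣                                 ≡⟨ cong ∣_∣ (det-p x₀∈C) ⟨
      ∣ Q ^ suc s * (W * P) ∣                       ≡⟨ abs-* (Q ^ suc s) (W * P) ⟩
      ∣ Q ^ suc s ∣ ℕ.* ∣ W * P ∣                   ≡⟨ cong₂ ℕ._*_ (abs-^ Q (suc s)) (abs-* W P) ⟩
      suc (suc q) ℕ.^ suc s ℕ.* (∣ W ∣ ℕ.* ∣ P ∣)   ∎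

  square-formula : ∀ c W f v → + f * W ≡ v → + (c ℕ.* (∣ W ∣ ℕ.* ∣ W ∣)) * (+ f * + f) ≡ + c * (v * v)
  square-formula c W f v fW≡v = begin
    + (c ℕ.* (∣ W ∣ ℕ.* ∣ W ∣)) * (+ f * + f)
      ≡⟨ cong (_* (+ f * + f)) (trans (pos-* c (∣ W ∣ ℕ.* ∣ W ∣)) (cong (+ c *_) (pos-abs² W))) ⟩
    + c * (W * W) * (+ f * + f)
      ≡⟨ regroup (+ c) W (+ f) ⟩
    + c * ((+ f * W) * (+ f * W))
      ≡⟨ cong (λ t → + c * (t * t)) fW≡v ⟩
    + c * (v * v) ∎
    where
    regroup : ∀ c w f → c * (w * w) * (f * f) ≡ c * ((f * w) * (f * w))
    regroup = solve-∀

  square-divides : ∀ c w p N s → N ℕ.^ s ≡ c ℕ.* (w ℕ.* p) → c ℕ.* (w ℕ.* w) ℕ∣.∣ N ℕ.^ (2 ℕ.* s)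
  square-divides c w p N s N^s≡ = ℕ∣.divides (c ℕ.* (p ℕ.* p)) (begin
    N ℕ.^ (2 ℕ.* s)                                  ≡⟨ ℕₚ.^-distribˡ-+-* N s (s ℕ.+ 0) ⟩
    N ℕ.^ s ℕ.* N ℕ.^ (s ℕ.+ 0)                      ≡⟨ cong (λ k → N ℕ.^ s ℕ.* N ℕ.^ k) (ℕₚ.+-identityʳ s) ⟩
    N ℕ.^ s ℕ.* N ℕ.^ s                              ≡⟨ cong₂ ℕ._*_ N^s≡ N^s≡ ⟩
    c ℕ.* (w ℕ.* p) ℕ.* (c ℕ.* (w ℕ.* p))            ≡⟨ regroup c w p ⟩
    c ℕ.* (p ℕ.* p) ℕ.* (c ℕ.* (w ℕ.* w))            ∎)
    where
    regroup : ∀ a w p → a ℕ.* (w ℕ.* p) ℕ.* (a ℕ.* (w ℕ.* p)) ≡ a ℕ.* (p ℕ.* p) ℕ.* (a ℕ.* (w ℕ.* w))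
    regroup = ℕ-Solver.solve-∀


open import Defs
open import Data.Nat using (ℕ; suc; _+_; _*_; _∸_; _^_; _≤_; s≤s; z≤n)
open import Data.Nat.DivMod using (_/_)
open import Data.Nat.Divisibility using (_∣_)
open import Data.Fin using (Fin)
open import Data.Integer using (ℤ; +_; ∣_∣) renaming (_*_ to _*ℤ_)
open import Data.Product using (Σ; ∃; _×_; _,_)
open import Relation.Binary.PropositionalEquality using (_≡_; _≢_)
open import Function.Definitions using (Injective)
open import Function.Bundles using (_⇔_)
open Factorization

theoremB5 : (n q s : ℕ) → 2 ≤ n → 2 ≤ q → 1 ≤ s →
    (C : Code q n) → IsDesign (2 * s ∸ 1) C →
    (α : Fin s → ℕ) → Injective _≡_ _≡_ α →
    ((d : ℕ) → InDegreeSet C d ⇔ ∃ (λ i → α i ≡ d)) →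
    size C ≢ tightSize n q s →
    Σ ℕ (λ m →
    (+ m *ℤ (+ superfact s *ℤ + superfact s)
    ≡ + (q ^ s) *ℤ ((+ (q ^ ((s * (s ∸ 1)) / 2)) *ℤ vandermonde α) *ℤ (+ (q ^ ((s * (s ∸ 1)) / 2)) *ℤ vandermonde α)))
    × (m ∣ size C ^ (2 * s)))
theoremB5 (suc n) q@(suc (suc _)) (suc s) (s≤s _) (s≤s (s≤s z≤n)) (s≤s z≤n) C design α α-injective degrees _ =
  let W , P , superfact-W , size-C = frame-factorization C design α α-injective degrees in
  -- `W` is the quotient inside the square of the theorem; its sign disappears on squaring.
  q ^ suc s * (∣ W ∣ * ∣ W ∣) ,
  square-formula (q ^ suc s) W (superfact (suc s)) _ superfact-W ,
  square-divides (q ^ suc s) (∣ W ∣) (∣ P ∣) (size C) (suc s) size-C
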